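{- Let $G$ be a graph and let $\alpha,\beta\in\mathbb{R}$ with $0<\alpha<\beta$. Then $$SDD_{\alpha}(G)\le SDD_{\beta}(G),$$ and equality holds if and only if each connected component of $G$ is a regular graph.
   Context: Graphs are finite, simple and undirected. For a graph $G$ with vertex set $V(G)$ and edge set $E(G)$, $d_u$ denotes the degree of the vertex $u$, and $uv$ denotes the edge joining $u$ and $v$. For $\alpha\in\mathbb{R}$, the variable symmetric division deg index is $$SDD_\alpha(G)=\sum_{uv\in E(G)}\left(\frac{d_u^\alpha}{d_v^\alpha}+\frac{d_v^\alpha}{d_u^\alpha}\right).$$ A graph is regular if all its vertices have the same degree. -}

module Defs where

open import Level using (0ℓ)
open import Data.Empty using (⊥; ⊥-elim)
open import Data.Product using (∃; ∃₂; _×_; _,_; proj₁; proj₂)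
open import Data.Sum using (_⊎_; inj₁; inj₂)
open import Data.Nat as ℕ using (ℕ; zero; suc)
import Data.Nat.Properties as ℕ
open import Data.Integer as ℤ using (ℤ; +_; -[1+_])
import Data.Integer.Properties as ℤ
open import Data.Rational hiding (∣_∣)
open import Data.Rational.Properties
import Data.Rational.Unnormalised as ℚᵘ
import Data.Rational.Unnormalised.Properties as ℚᵘ
open import Tactic.RingSolver using (solve-∀)
open import Tactic.RingSolver.Core.AlmostCommutativeRing using (fromCommutativeRing)
open import Algebra.Bundles using (CommutativeRing)
open import Algebra.Properties.CommutativeSemiring.Exp
  (CommutativeRing.commutativeSemiring +-*-commutativeRing)
  using (_^_; ^-assocʳ; ^-distrib-*)
open import Data.Fin using (Fin; zero; suc) renaming (_<_ to _<ᶠ_)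
open import Data.Fin.Properties using () renaming (_<?_ to _<ᶠ?_)
open import Data.Fin.Subset using (Subset; inside; outside; ∣_∣; _∈_; Nonempty)
open import Data.Fin.Subset.Properties using (x∈p⇒∣p-x∣<∣p∣)
open import Data.Vec using ([]; _∷_; tabulate)
open import Data.Vec.Properties using (lookup⇒[]=; lookup∘tabulate)
open import Data.List as List using (List; mapMaybe; cartesianProduct; allFin; foldr)
open import Data.Maybe using (Maybe)
import Data.Maybe as Maybe
open import Relation.Nullary using (Dec; yes; no; does)
open import Relation.Nullary.Decidable using (dec-true; dec⇒maybe; _×-dec_)
open import Relation.Binary using (Rel; Decidable; Symmetric; Irreflexive; tri<; tri≈; tri>)
open import Relation.Binary.Construct.Closure.ReflexiveTransitive using (Star)
open import Relation.Binary.PropositionalEquality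
open import Function using (_⇔_)

ℚ-ring = fromCommutativeRing +-*-commutativeRing (λ x → dec⇒maybe (0ℚ ≟ x))

a+[q-a] : ∀ a q → a + (q - a) ≡ q
a+[q-a] = solve-∀ ℚ-ring

r-[a+[r-q]] : ∀ q r a → r - (a + (r - q)) ≡ q - a
r-[a+[r-q]] = solve-∀ ℚ-ring

q*[b+ε] : ∀ q b ε → q * b + ε * q ≡ q * (b + ε)
q*[b+ε] = solve-∀ ℚ-ring

qb+[r-q]b : ∀ q r b → q * b + (r - q) * b ≡ r * b
qb+[r-q]b = solve-∀ ℚ-ring

bernoulli-step : ∀ K a → 1ℚ + (1ℚ + K) * (a - 1ℚ) ≡ 1ℚ + K * (a - 1ℚ) + (a - 1ℚ) * 1ℚ
bernoulli-step = solve-∀ ℚ-ring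

p+[a-1]p : ∀ p a → p + (a - 1ℚ) * p ≡ a * p
p+[a-1]p = solve-∀ ℚ-ring

*-monoʳ-< : ∀ {c a b} → 0ℚ < c → a < b → a * c < b * c
*-monoʳ-< {c} 0<c = *-monoˡ-<-pos c {{positive 0<c}}

*-monoˡ-< : ∀ {c a b} → 0ℚ < c → a < b → c * a < c * b
*-monoˡ-< {c} 0<c = *-monoʳ-<-pos c {{positive 0<c}}

*-monoʳ-≤ : ∀ {c a b} → 0ℚ ≤ c → a ≤ b → a * c ≤ b * c
*-monoʳ-≤ {c} 0≤c = *-monoʳ-≤-nonNeg c {{nonNegative 0≤c}}

*-monoˡ-≤ : ∀ {c a b} → 0ℚ ≤ c → a ≤ b → c * a ≤ c * b
*-monoˡ-≤ {c} 0≤c = *-monoˡ-≤-nonNeg c {{nonNegative 0≤c}}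

*-mono-≤ : ∀ {a b c d} → 0ℚ ≤ a → 0ℚ ≤ d → a ≤ b → c ≤ d → a * c ≤ b * d
*-mono-≤ 0≤a 0≤d a≤b c≤d = ≤-trans (*-monoˡ-≤ 0≤a c≤d) (*-monoʳ-≤ 0≤d a≤b)

*-cancelʳ-< : ∀ {c a b} → 0ℚ < c → a * c < b * c → a < b
*-cancelʳ-< {c} 0<c = *-cancelʳ-<-nonNeg c {{nonNegative (<⇒≤ 0<c)}}

*-pos : ∀ {a b} → 0ℚ < a → 0ℚ < b → 0ℚ < a * b
*-pos {a} {b} 0<a 0<b = subst (_< a * b) (*-zeroˡ b) (*-monoʳ-< 0<b 0<a)

*-nonNeg : ∀ {a b} → 0ℚ ≤ a → 0ℚ ≤ b → 0ℚ ≤ a * b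
*-nonNeg {a} {b} 0≤a 0≤b = subst (_≤ a * b) (*-zeroˡ b) (*-monoʳ-≤ 0≤b 0≤a)

0<1 : 0ℚ < 1ℚ
0<1 = positive⁻¹ 1ℚ

m<m+ε : ∀ m {ε} → 0ℚ < ε → m < m + ε
m<m+ε m {ε} 0<ε = subst (_< m + ε) (+-identityʳ m) (+-monoʳ-< m 0<ε)

m-1<m : ∀ m → m - 1ℚ < m
m-1<m m = subst (m - 1ℚ <_) (+-identityʳ m) (+-monoʳ-< m (negative⁻¹ (- 1ℚ)))

<⇒0<- : ∀ {a b} → a < b → 0ℚ < b - a
<⇒0<- {a} {b} a<b = subst (_< b - a) (+-inverseʳ a) (+-monoˡ-< (- a) a<b)

divide : ∀ c {b} → 0ℚ < b → ∃ λ r → r * b ≡ c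
divide c {b} 0<b = c * (1/ b) , trans (*-assoc c (1/ b) b)
    (trans (cong (c *_) (*-inverseˡ b)) (*-identityʳ c))
  where instance b≢0 = >-nonZero 0<b

frac-mono-< : ∀ {i j} k → i ℤ.< j → i / suc k < j / suc k
frac-mono-< {i} {j} k i<j = toℚᵘ-cancel-<
  (ℚᵘ.<-respʳ-≃ (ℚᵘ.≃-sym (toℚᵘ-fromℚᵘ (ℚᵘ.mkℚᵘ j k)))
  (ℚᵘ.<-respˡ-≃ (ℚᵘ.≃-sym (toℚᵘ-fromℚᵘ (ℚᵘ.mkℚᵘ i k)))
    (ℚᵘ.*<* (ℤ.*-monoʳ-<-pos (+ suc k) i<j))))

frac-cross-< : ∀ {i j} k l → i / suc k < j / suc l → i ℤ.* + suc l ℤ.< j ℤ.* + suc k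
frac-cross-< {i} {j} k l h = ℚᵘ.drop-*<*
  (ℚᵘ.<-respʳ-≃ (toℚᵘ-fromℚᵘ (ℚᵘ.mkℚᵘ j l))
  (ℚᵘ.<-respˡ-≃ (toℚᵘ-fromℚᵘ (ℚᵘ.mkℚᵘ i k)) (toℚᵘ-mono-< h)))

frac-≤ : ∀ i k b → i ℤ.* ↧ b ℤ.≤ ↥ b ℤ.* + suc k → i / suc k ≤ b
frac-≤ i k b@record{} h = toℚᵘ-cancel-≤
  (ℚᵘ.≤-respˡ-≃ (ℚᵘ.≃-sym (toℚᵘ-fromℚᵘ (ℚᵘ.mkℚᵘ i k))) (ℚᵘ.*≤* h))

frac-≥ : ∀ i k b → ↥ b ℤ.* + suc k ℤ.≤ i ℤ.* ↧ b → b ≤ i / suc k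
frac-≥ i k b@record{} h = toℚᵘ-cancel-≤
  (ℚᵘ.≤-respʳ-≃ (ℚᵘ.≃-sym (toℚᵘ-fromℚᵘ (ℚᵘ.mkℚᵘ i k))) (ℚᵘ.*≤* h))

frac-+ : ∀ i j k → (i ℤ.+ j) / suc k ≡ i / suc k + j / suc k
frac-+ i j k = toℚᵘ-injective (begin
  toℚᵘ ((i ℤ.+ j) / suc k)                       ≈⟨ toℚᵘ-fromℚᵘ (ℚᵘ.mkℚᵘ (i ℤ.+ j) k) ⟩
  ℚᵘ.mkℚᵘ (i ℤ.+ j) k                            ≈⟨ ℚᵘ.*≡* eq ⟩
  ℚᵘ.mkℚᵘ i k ℚᵘ.+ ℚᵘ.mkℚᵘ j k                   ≈⟨ ℚᵘ.+-cong (toℚᵘ-fromℚᵘ (ℚᵘ.mkℚᵘ i k)) (toℚᵘ-fromℚᵘ (ℚᵘ.mkℚᵘ j k)) ⟨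
  toℚᵘ (i / suc k) ℚᵘ.+ toℚᵘ (j / suc k)         ≈⟨ toℚᵘ-homo-+ (i / suc k) (j / suc k) ⟨
  toℚᵘ (i / suc k + j / suc k)                   ∎)
  where
  open ℚᵘ.≃-Reasoning
  K = + suc k
  eq : (i ℤ.+ j) ℤ.* (K ℤ.* K) ≡ (i ℤ.* K ℤ.+ j ℤ.* K) ℤ.* K
  eq = trans (sym (ℤ.*-assoc (i ℤ.+ j) K K)) (cong (ℤ._* K) (ℤ.*-distribʳ-+ K i j))

bound : ∀ k q → let m = ℤ.∣ ↥ q ∣ ℕ.* suc k in
        ℤ.- (+ m) / suc k ≤ q × q ≤ + m / suc k
bound k q@(mkℚ n d _) =
    frac-≤ (ℤ.- + m) k q (subst (ℤ._≤ n ℤ.* + suc k) (ℤ.neg-distribˡ-* (+ m) (+ suc d))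
      (ℤ.≤-trans (ℤ.neg-mono-≤ m≤md) (proj₁ n-bound)))
  , frac-≥ (+ m) k q (ℤ.≤-trans (proj₂ n-bound) m≤md)
  where
  m = ℤ.∣ n ∣ ℕ.* suc k
  m≤md : + m ℤ.≤ + m ℤ.* + suc d
  m≤md = subst (+ m ℤ.≤_) (ℤ.pos-* m (suc d)) (ℤ.+≤+ (ℕ.m≤m*n m (suc d)))
  abs : ∀ i → ℤ.- (+ ℤ.∣ i ∣) ℤ.≤ i × i ℤ.≤ + ℤ.∣ i ∣
  abs (+ a)     = ℤ.≤-trans (ℤ.neg-mono-≤ (ℤ.+≤+ (ℕ.z≤n {a}))) (ℤ.+≤+ ℕ.z≤n) , ℤ.≤-refl
  abs -[1+ a ]  = ℤ.≤-refl , ℤ.-≤+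
  n-bound : ℤ.- + m ℤ.≤ n ℤ.* + suc k × n ℤ.* + suc k ℤ.≤ + m
  n-bound = subst (λ t → ℤ.- + t ℤ.≤ n ℤ.* + suc k × n ℤ.* + suc k ℤ.≤ + t)
    (ℤ.abs-* n (+ suc k)) (abs (n ℤ.* + suc k))

-- Two-sided Dedekind cuts: Lower x q means q < x and Upper x q means x < q.
record ℝ : Set₁ where
  field
    Lower Upper     : ℚ → Set
    lower-inhabited : ∃ Lower
    upper-inhabited : ∃ Upper
    lower-closed    : ∀ {q r} → q < r → Lower r → Lower q
    upper-closed    : ∀ {q r} → q < r → Upper q → Upper r
    lower-open      : ∀ {q} → Lower q → ∃ λ r → q < r × Lower r
    upper-open      : ∀ {r} → Upper r → ∃ λ q → q < r × Upper q
    disjoint        : ∀ {q} → Lower q → Upper q → ⊥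
    located         : ∀ {q r} → q < r → Lower q ⊎ Upper r

open ℝ

infix 4 _≤ℝ_ _<ℝ_ _≃ℝ_

_≤ℝ_ : ℝ → ℝ → Set
x ≤ℝ y = ∀ q → Lower x q → Lower y q

_<ℝ_ : ℝ → ℝ → Set
x <ℝ y = ∃ λ q → Upper x q × Lower y q

_≃ℝ_ : ℝ → ℝ → Set
x ≃ℝ y = x ≤ℝ y × y ≤ℝ x

fromℚ : ℚ → ℝ
fromℚ s = record
  { Lower           = _< s
  ; Upper           = s <_
  ; lower-inhabited = s - 1ℚ , m-1<m s
  ; upper-inhabited = s + 1ℚ , m<m+ε s 0<1
  ; lower-closed    = <-trans
  ; upper-closed    = λ q<r s<q → <-trans s<q q<r
  ; lower-open      = λ q<s → let (m , q<m , m<s) = <-dense q<s in m , q<m , m<s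
  ; upper-open      = λ s<r → let (m , s<m , m<r) = <-dense s<r in m , m<r , s<m
  ; disjoint        = <-asym
  ; located         = loc
  }
  where
  loc : ∀ {q r} → q < r → q < s ⊎ s < r
  loc {q} q<r with q <? s
  ... | yes q<s = inj₁ q<s
  ... | no  q≮s = inj₂ (≤-<-trans (≮⇒≥ q≮s) q<r)

0ℝ : ℝ
0ℝ = fromℚ 0ℚ

ℝ⁺ : Set₁
ℝ⁺ = ∃ λ x → 0ℝ <ℝ x

lower-≤ : ∀ x {q r} → q ≤ r → Lower x r → Lower x q
lower-≤ x {q} {r} q≤r r∈L with <-cmp q r
... | tri< q<r _ _ = lower-closed x q<r r∈L
... | tri≈ _ q≡r _ = subst (Lower x) (sym q≡r) r∈L
... | tri> _ _ r<q = ⊥-elim (<-irrefl refl (<-≤-trans r<q q≤r))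

upper-≤ : ∀ x {q r} → q ≤ r → Upper x q → Upper x r
upper-≤ x {q} {r} q≤r q∈U with <-cmp q r
... | tri< q<r _ _ = upper-closed x q<r q∈U
... | tri≈ _ q≡r _ = subst (Upper x) q≡r q∈U
... | tri> _ _ r<q = ⊥-elim (<-irrefl refl (<-≤-trans r<q q≤r))

lower<upper : ∀ x {q r} → Lower x q → Upper x r → q < r
lower<upper x {q} {r} q∈L r∈U with q <? r
... | yes q<r = q<r
... | no  q≮r = ⊥-elim (disjoint x q∈L (upper-≤ x (≮⇒≥ q≮r) r∈U))

Bracket : ℝ → ℕ → ℤ → Set
Bracket x k i = Lower x (i / suc k) × Upper x (ℤ.suc (ℤ.suc i) / suc k)

i<suc : ∀ i → i ℤ.< ℤ.suc i
i<suc i = ℤ.suc[i]≤j⇒i<j ℤ.≤-refl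

walk : ∀ x k m i → Lower x (i / suc k) → Upper x ((i ℤ.+ + m) / suc k) → ∃ (Bracket x k)
walk x k zero i l u =
  ⊥-elim (disjoint x l (subst (λ t → Upper x (t / suc k)) (ℤ.+-identityʳ i) u))
walk x k (suc m) i l u
  with located x (frac-mono-< k (i<suc (ℤ.suc i)))
... | inj₂ u′ = i , l , u′
... | inj₁ l′ = walk x k m (ℤ.suc i) l′ (subst (λ t → Upper x (t / suc k)) eq u)
  where
  eq : i ℤ.+ + suc m ≡ ℤ.suc i ℤ.+ + m
  eq = trans (sym (ℤ.+-assoc i (+ 1) (+ m))) (cong (ℤ._+ + m) (ℤ.+-comm i (+ 1)))

bracket : ∀ x k → ∃ (Bracket x k)
bracket x k =
  let (a , a∈L) = lower-inhabited x
      (b , b∈U) = upper-inhabited x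
      m = ℤ.∣ ↥ a ∣ ℕ.* suc k
      n = ℤ.∣ ↥ b ∣ ℕ.* suc k
      eq : + n ≡ ℤ.- (+ m) ℤ.+ + (m ℕ.+ n)
      eq = sym (trans (sym (ℤ.+-assoc (ℤ.- (+ m)) (+ m) (+ n)))
             (trans (cong (ℤ._+ + n) (ℤ.+-inverseˡ (+ m))) (ℤ.+-identityˡ (+ n))))
  in walk x k (m ℕ.+ n) (ℤ.- (+ m))
       (lower-≤ x (proj₁ (bound k a)) a∈L)
       (subst (λ t → Upper x (t / suc k)) eq (upper-≤ x (proj₂ (bound k b)) b∈U))

small : ∀ {ε} → 0ℚ < ε → ∃ λ k → + 2 / suc k < ε
small {mkℚ (+ zero) d c}  (*<* (ℤ.+<+ ()))
small {mkℚ -[1+ n ] d c}  (*<* ())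
small {mkℚ (+ suc n) d c} _ = 2 ℕ.* suc d ,
  toℚᵘ-cancel-< (ℚᵘ.<-respˡ-≃ (ℚᵘ.≃-sym (toℚᵘ-fromℚᵘ (ℚᵘ.mkℚᵘ (+ 2) (2 ℕ.* suc d))))
    (ℚᵘ.*<* (subst₂ ℤ._<_ (ℤ.pos-* 2 (suc d)) (ℤ.pos-* (suc n) (suc (2 ℕ.* suc d)))
      (ℤ.+<+ (ℕ.m≤n*m (suc (2 ℕ.* suc d)) (suc n))))))

approx : ∀ x {ε} → 0ℚ < ε → ∃₂ λ a b → Lower x a × Upper x b × b < a + ε
approx x {ε} 0<ε =
  let (k , 2/k<ε) = small 0<ε
      (i , l , u) = bracket x k
      eq : i / suc k + + 2 / suc k ≡ ℤ.suc (ℤ.suc i) / suc k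
      eq = trans (sym (frac-+ i (+ 2) k))
             (cong (λ t → t / suc k) (trans (ℤ.+-comm i (+ 2)) (ℤ.+-assoc (+ 1) (+ 1) i)))
  in i / suc k , ℤ.suc (ℤ.suc i) / suc k , l , u
     , subst (_< i / suc k + ε) eq (+-monoʳ-< (i / suc k) 2/k<ε)

infixl 6 _+ℝ_
infixl 7 _÷ℝ_

_+ℝ_ : ℝ → ℝ → ℝ
x +ℝ y = record
  { Lower           = λ q → ∃₂ λ a b → Lower x a × Lower y b × q < a + b
  ; Upper           = λ q → ∃₂ λ a b → Upper x a × Upper y b × a + b < q
  ; lower-inhabited = let (a , l) = lower-inhabited x
                          (b , m) = lower-inhabited y
                      in a + b - 1ℚ , a , b , l , m , m-1<m (a + b)
  ; upper-inhabited = let (a , l) = upper-inhabited x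
                          (b , m) = upper-inhabited y
                      in a + b + 1ℚ , a , b , l , m , m<m+ε (a + b) 0<1
  ; lower-closed    = λ { q<r (a , b , l , m , h) → a , b , l , m , <-trans q<r h }
  ; upper-closed    = λ { q<r (a , b , l , m , h) → a , b , l , m , <-trans h q<r }
  ; lower-open      = λ { (a , b , l , m , h) →
                          let (c , q<c , c<ab) = <-dense h in c , q<c , a , b , l , m , c<ab }
  ; upper-open      = λ { (a , b , l , m , h) →
                          let (c , ab<c , c<q) = <-dense h in c , c<q , a , b , l , m , ab<c }
  ; disjoint        = λ { (a , b , l , m , h) (c , d , l′ , m′ , h′) →
                          <-asym (<-trans h′ h) (+-mono-< (lower<upper x l l′) (lower<upper y m m′)) }
  ; located         = loc
  }
  where
  loc : ∀ {q r} → q < r →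
    (∃₂ λ a b → Lower x a × Lower y b × q < a + b) ⊎ (∃₂ λ a b → Upper x a × Upper y b × a + b < r)
  loc {q} {r} q<r =
    let (a , a′ , l , u , a′<a+ε) = approx x (<⇒0<- q<r)
        q-a<r-a′ = subst (_< r - a′) (r-[a+[r-q]] q r a) (+-monoʳ-< r (neg-antimono-< a′<a+ε))
    in go {a} {a′} l u (located y q-a<r-a′)
    where
    go : ∀ {a a′} → Lower x a → Upper x a′ → Lower y (q - a) ⊎ Upper y (r - a′) →
         (∃₂ λ a b → Lower x a × Lower y b × q < a + b) ⊎ (∃₂ λ a b → Upper x a × Upper y b × a + b < r)
    go {a} {a′} l u (inj₁ m) = let (b , h , m′) = lower-open y m in
      inj₁ (a , b , l , m′ , subst (_< a + b) (a+[q-a] a q) (+-monoʳ-< a h))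
    go {a} {a′} l u (inj₂ m) = let (b , h , m′) = upper-open y m in
      inj₂ (a′ , b , u , m′ , subst (a′ + b <_) (a+[q-a] a′ r) (+-monoʳ-< a′ h))

pos⇒lower : ∀ x → 0ℝ <ℝ x → Lower x 0ℚ
pos⇒lower x (q , 0<q , q∈L) = lower-closed x 0<q q∈L

-- Since x , y > 0, q < x / y iff q b < a for some a < x and b > y, and
-- x / y < q iff a < q b for some a > x and 0 < b < y.
_÷ℝ_ : ℝ⁺ → ℝ⁺ → ℝ
(x , 0<x) ÷ℝ (y , 0<y) = record
  { Lower           = L
  ; Upper           = U
  ; lower-inhabited =
      let (a₀ , 0<a₀ , a₀∈L) = 0<x ; (b , b∈U) = upper-inhabited y
      in 0ℚ , a₀ , b , a₀∈L , b∈U , subst (_< a₀) (sym (*-zeroˡ b)) 0<a₀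
  ; upper-inhabited =
      let (a , a∈U) = upper-inhabited x ; (b₀ , 0<b₀ , b₀∈L) = 0<y
          (r , rb≡) = divide (a + 1ℚ) 0<b₀
      in r , a , b₀ , a∈U , b₀∈L , 0<b₀ , subst (a <_) (sym rb≡) (m<m+ε a 0<1)
  ; lower-closed    = λ { q<r (a , b , l , u , h) →
      a , b , l , u , <-trans (*-monoʳ-< (upper-pos u) q<r) h }
  ; upper-closed    = λ { q<r (a , b , u , l , 0<b , h) →
      a , b , u , l , 0<b , <-trans h (*-monoʳ-< 0<b q<r) }
  ; lower-open      = λ { (a , b , l , u , h) →
      let (c , qb<c , c<a) = <-dense h
          (r , rb≡c) = divide c (upper-pos u)
      in r , *-cancelʳ-< (upper-pos u) (subst (_ <_) (sym rb≡c) qb<c)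
           , a , b , l , u , subst (_< a) (sym rb≡c) c<a }
  ; upper-open      = λ { (a , b , u , l , 0<b , h) →
      let (c , a<c , c<qb) = <-dense h
          (r , rb≡c) = divide c 0<b
      in r , *-cancelʳ-< 0<b (subst (_< _) (sym rb≡c) c<qb)
           , a , b , u , l , 0<b , subst (a <_) (sym rb≡c) a<c }
  ; disjoint        = λ {q} → disj {q}
  ; located         = loc
  }
  where
  L U : ℚ → Set
  L q = ∃₂ λ a b → Lower x a × Upper y b × q * b < a
  U q = ∃₂ λ a b → Upper x a × Lower y b × 0ℚ < b × a < q * b

  upper-pos : ∀ {b} → Upper y b → 0ℚ < b
  upper-pos = lower<upper y (pos⇒lower y 0<y)

  disj : ∀ {q} → L q → U q → ⊥
  disj {q} (a , b , l , u , qb<a) (a′ , b′ , u′ , l′ , 0<b′ , a′<qb′) with 0ℚ ≤? q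
  ... | yes 0≤q = <-irrefl refl (<-trans qb<a (<-trans (lower<upper x l u′)
                    (<-≤-trans a′<qb′ (*-monoˡ-≤ 0≤q (<⇒≤ (lower<upper y l′ u))))))
  ... | no  0≰q = <-irrefl refl (<-trans (lower<upper x (pos⇒lower x 0<x) u′)
                    (<-trans a′<qb′ (subst (q * b′ <_) (*-zeroˡ b′) (*-monoʳ-< 0<b′ (≰⇒> 0≰q)))))

  loc : ∀ {q r} → q < r → L q ⊎ U r
  loc {q} {r} q<r with 0ℚ <? q
  ... | no 0≮q =
    let (a₀ , 0<a₀ , a₀∈L) = 0<x ; (b , b∈U) = upper-inhabited y
    in inj₁ (a₀ , b , a₀∈L , b∈U , ≤-<-trans
         (subst (q * b ≤_) (*-zeroˡ b) (*-monoʳ-≤ (<⇒≤ (upper-pos b∈U)) (≮⇒≥ 0≮q))) 0<a₀)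
  ... | yes 0<q = go above
    where
    b₀ = proj₁ 0<y
    ε  = proj₁ (divide ((r - q) * b₀) 0<q)
    εq≡ : ε * q ≡ (r - q) * b₀
    εq≡ = proj₂ (divide ((r - q) * b₀) 0<q)
    0<rqb : 0ℚ < (r - q) * b₀
    0<rqb = *-pos (<⇒0<- q<r) (proj₁ (proj₂ 0<y))
    0<ε : 0ℚ < ε
    0<ε = *-cancelʳ-< 0<q (subst₂ _<_ (sym (*-zeroˡ q)) (sym εq≡) 0<rqb)

    above : ∃₂ λ b b′ → Lower y b × Upper y b′ × b′ < b + ε × b₀ ≤ b
    above = let (b , b′ , l , u , h) = approx y 0<ε in raise l u h (≤-total b₀ b)
      where
      raise : ∀ {b b′} → Lower y b → Upper y b′ → b′ < b + ε → b₀ ≤ b ⊎ b ≤ b₀ →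
              ∃₂ λ b b′ → Lower y b × Upper y b′ × b′ < b + ε × b₀ ≤ b
      raise {b} {b′} l u h (inj₁ b₀≤b) = b , b′ , l , u , h , b₀≤b
      raise {b} {b′} l u h (inj₂ b≤b₀) =
        b₀ , b′ , proj₂ (proj₂ 0<y) , u , <-≤-trans h (+-monoˡ-≤ ε b≤b₀) , ≤-refl

    go : (∃₂ λ b b′ → Lower y b × Upper y b′ × b′ < b + ε × b₀ ≤ b) → L q ⊎ U r
    go (b , b′ , l , u , h , b₀≤b) = split (located x qb′<rb)
      where
      qb′<rb : q * b′ < r * b
      qb′<rb = <-≤-trans (*-monoˡ-< 0<q h) (subst₂ _≤_
        (trans (cong (λ z → q * b + z) (sym εq≡)) (q*[b+ε] q b ε))
        (qb+[r-q]b q r b)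
        (+-monoʳ-≤ (q * b) (*-monoˡ-≤ (<⇒≤ (<⇒0<- q<r)) b₀≤b)))
      split : Lower x (q * b′) ⊎ Upper x (r * b) → L q ⊎ U r
      split (inj₁ m) = let (a , k , m′) = lower-open x m in inj₁ (a , b′ , m′ , u , k)
      split (inj₂ m) = let (a , k , m′) = upper-open x m
                       in inj₂ (a , b , m′ , l , <-≤-trans (proj₁ (proj₂ 0<y)) b₀≤b , k)

fromℕ : ℕ → ℚ
fromℕ n = + n / 1

infixr 8 _^ℤ_ _^ℝ_

_^ℤ_ : (n : ℕ) → .{{_ : ℕ.NonZero n}} → ℤ → ℚ
n ^ℤ (+ m)    = fromℕ n ^ m
n ^ℤ -[1+ m ] = (+ 1 / n) ^ suc m

^-pos : ∀ {a} → 0ℚ < a → ∀ m → 0ℚ < a ^ m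
^-pos 0<a zero    = 0<1
^-pos 0<a (suc m) = *-pos 0<a (^-pos 0<a m)

^-nonNeg : ∀ {a} → 0ℚ ≤ a → ∀ m → 0ℚ ≤ a ^ m
^-nonNeg 0≤a zero    = <⇒≤ 0<1
^-nonNeg 0≤a (suc m) = *-nonNeg 0≤a (^-nonNeg 0≤a m)

^-mono-≤ : ∀ {a b} → 0ℚ ≤ a → a ≤ b → ∀ m → a ^ m ≤ b ^ m
^-mono-≤ 0≤a a≤b zero    = ≤-refl
^-mono-≤ 0≤a a≤b (suc m) =
  *-mono-≤ 0≤a (^-nonNeg (≤-trans 0≤a a≤b) m) a≤b (^-mono-≤ 0≤a a≤b m)

^-mono-< : ∀ {a b} → 0ℚ ≤ a → a < b → ∀ m → a ^ suc m < b ^ suc m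
^-mono-< {a} {b} 0≤a a<b m = ≤-<-trans
  (*-monoˡ-≤ 0≤a (^-mono-≤ 0≤a (<⇒≤ a<b) m))
  (*-monoʳ-< (^-pos (≤-<-trans 0≤a a<b) m) a<b)

^-swap : ∀ a k l → (a ^ k) ^ l ≡ (a ^ l) ^ k
^-swap a k l = trans (^-assocʳ a k l) (trans (cong (a ^_) (ℕ.*-comm k l)) (sym (^-assocʳ a l k)))

1≤^ : ∀ {a} → 1ℚ ≤ a → ∀ m → 1ℚ ≤ a ^ m
1≤^ 1≤a zero    = ≤-refl
1≤^ {a} 1≤a (suc m) = ≤-trans 1≤a (subst (_≤ a * a ^ m) (*-identityʳ a)
  (*-monoˡ-≤ (≤-trans (<⇒≤ 0<1) 1≤a) (1≤^ 1≤a m)))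

bernoulli : ∀ {a} → 1ℚ ≤ a → ∀ k → 1ℚ + fromℕ k * (a - 1ℚ) ≤ a ^ k
bernoulli {a} 1≤a zero = ≤-reflexive (trans (cong (λ z → 1ℚ + z) (*-zeroˡ (a - 1ℚ))) (+-identityʳ 1ℚ))
bernoulli {a} 1≤a (suc k) = ≤-trans
  (≤-reflexive (trans (cong (λ t → 1ℚ + t * (a - 1ℚ)) (frac-+ (+ 1) (+ k) 0))
    (bernoulli-step (fromℕ k) a)))
  (≤-trans (+-mono-≤ (bernoulli 1≤a k)
             (*-monoˡ-≤ (subst (_≤ a - 1ℚ) (+-inverseʳ 1ℚ) (+-monoˡ-≤ (- 1ℚ) 1≤a)) (1≤^ 1≤a k)))
    (≤-reflexive (p+[a-1]p (a ^ k) a)))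

archimedean : ∀ {a} → 1ℚ < a → ∀ c → ∃ λ k → c ≤ a ^ suc k
archimedean {a} 1<a c =
  let 0<δ = <⇒0<- 1<a
      (d , dδ≡c) = divide c 0<δ
      k = ℤ.∣ ↥ d ∣ ℕ.* 1
      open ≤-Reasoning
  in k , (begin
    c                              ≡⟨ sym dδ≡c ⟩
    d * (a - 1ℚ)                   ≤⟨ *-monoʳ-≤ (<⇒≤ 0<δ) (proj₂ (bound 0 d)) ⟩
    fromℕ k * (a - 1ℚ)             ≡⟨ sym (+-identityˡ (fromℕ k * (a - 1ℚ))) ⟩
    0ℚ + fromℕ k * (a - 1ℚ)        ≤⟨ +-monoˡ-≤ (fromℕ k * (a - 1ℚ)) (<⇒≤ 0<1) ⟩
    1ℚ + fromℕ k * (a - 1ℚ)        ≤⟨ bernoulli (<⇒≤ 1<a) k ⟩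
    a ^ k                          ≡⟨ sym (*-identityˡ (a ^ k)) ⟩
    1ℚ * a ^ k                     ≤⟨ *-monoʳ-≤ (^-nonNeg (<⇒≤ (<-trans 0<1 1<a)) k) (<⇒≤ 1<a) ⟩
    a * a ^ k                      ∎)

fromℕ*1/ : ∀ n .{{_ : ℕ.NonZero n}} → fromℕ n * (+ 1 / n) ≡ 1ℚ
fromℕ*1/ n@(suc m) = toℚᵘ-injective (begin
  toℚᵘ (fromℕ n * (+ 1 / n))              ≈⟨ toℚᵘ-homo-* (fromℕ n) (+ 1 / n) ⟩
  toℚᵘ (fromℕ n) ℚᵘ.* toℚᵘ (+ 1 / n)      ≈⟨ ℚᵘ.*-cong (toℚᵘ-fromℚᵘ (ℚᵘ.mkℚᵘ (+ n) 0)) (toℚᵘ-fromℚᵘ (ℚᵘ.mkℚᵘ (+ 1) m)) ⟩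
  ℚᵘ.mkℚᵘ (+ n) 0 ℚᵘ.* ℚᵘ.mkℚᵘ (+ 1) m    ≈⟨ ℚᵘ.*≡* (trans (ℤ.*-identityʳ (+ n ℤ.* + 1)) (trans (ℤ.*-identityʳ (+ n)) (sym (trans (ℤ.*-identityˡ (+ (1 ℕ.* n))) (cong (λ t → + t) (ℕ.*-identityˡ n)))))) ⟩
  toℚᵘ 1ℚ                                 ∎)
  where open ℚᵘ.≃-Reasoning

module _ (n : ℕ) .{{n≢0 : ℕ.NonZero n}} where

  0<fromℕ : 0ℚ < fromℕ n
  0<fromℕ = positive⁻¹ (fromℕ n) {{normalize-pos n 1}}

  1≤fromℕ : 1ℚ ≤ fromℕ n
  1≤fromℕ = frac-≥ (+ n) 0 1ℚ (subst (+ 1 ℤ.≤_) (sym (ℤ.*-identityʳ (+ n)))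
              (ℤ.+≤+ (ℕ.>-nonZero⁻¹ n)))

  ^ℤ-pos : ∀ i → 0ℚ < n ^ℤ i
  ^ℤ-pos (+ m)    = ^-pos 0<fromℕ m
  ^ℤ-pos -[1+ m ] = ^-pos (positive⁻¹ (+ 1 / n) {{normalize-pos 1 n}}) (suc m)

  ^ℤ-suc : ∀ i → n ^ℤ ℤ.suc i ≡ fromℕ n * n ^ℤ i
  ^ℤ-suc (+ m)          = refl
  ^ℤ-suc -[1+ zero ]    = sym (trans (cong (fromℕ n *_) (*-identityʳ (+ 1 / n))) (fromℕ*1/ n))
  ^ℤ-suc -[1+ suc m ]   = sym (trans (sym (*-assoc (fromℕ n) (+ 1 / n) ((+ 1 / n) ^ suc m)))
    (trans (cong (_* (+ 1 / n) ^ suc m) (fromℕ*1/ n)) (*-identityˡ ((+ 1 / n) ^ suc m))))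

  ^ℤ-mono-+ : ∀ i m → n ^ℤ i ≤ n ^ℤ (+ m ℤ.+ i)
  ^ℤ-mono-+ i zero    = ≤-reflexive (cong (n ^ℤ_) (sym (ℤ.+-identityˡ i)))
  ^ℤ-mono-+ i (suc m) = ≤-trans (^ℤ-mono-+ i m) (≤-trans
    (subst (_≤ fromℕ n * n ^ℤ (+ m ℤ.+ i)) (*-identityˡ _)
      (*-monoʳ-≤ (<⇒≤ (^ℤ-pos (+ m ℤ.+ i))) 1≤fromℕ))
    (≤-reflexive (trans (sym (^ℤ-suc (+ m ℤ.+ i)))
      (cong (n ^ℤ_) (sym (ℤ.+-assoc (+ 1) (+ m) i))))))

  ^ℤ-mono : ∀ {i j} → i ℤ.≤ j → n ^ℤ i ≤ n ^ℤ j
  ^ℤ-mono {i} {j} i≤j = subst (λ t → n ^ℤ i ≤ n ^ℤ t) eq (^ℤ-mono-+ i ℤ.∣ j ℤ.- i ∣)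
    where
    eq : + ℤ.∣ j ℤ.- i ∣ ℤ.+ i ≡ j
    eq = trans (cong (ℤ._+ i) (ℤ.0≤i⇒+∣i∣≡i (ℤ.i≤j⇒0≤j-i i≤j)))
           (trans (ℤ.+-assoc j (ℤ.- i) i)
             (trans (cong (λ z → j ℤ.+ z) (ℤ.+-inverseˡ i)) (ℤ.+-identityʳ j)))

  ^ℤ-* : ∀ i k → (n ^ℤ i) ^ suc k ≡ n ^ℤ (i ℤ.* + suc k)
  ^ℤ-* (+ m)    k = trans (^-assocʳ (fromℕ n) m (suc k)) (cong (n ^ℤ_) (ℤ.pos-* m (suc k)))
  ^ℤ-* -[1+ m ] k = ^-assocʳ (+ 1 / n) (suc m) (suc k)

-- As n ≥ 1, the map i / k ↦ n ^ (i / k) is nondecreasing on ℚ, so n ^ α is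
-- its supremum over i / k < α and its infimum over i / k > α.  The bound
-- s ≤ n ^ (i / k), for s ≥ 0, is s ^ k ≤ n ^ i.  The denominator is stored as
-- its predecessor.
_^ℝ_ : (n : ℕ) → .{{_ : ℕ.NonZero n}} → ℝ → ℝ
n ^ℝ α = record
  { Lower           = L
  ; Upper           = U
  ; lower-inhabited = - 1ℚ , below (negative⁻¹ (- 1ℚ))
  ; upper-inhabited =
      let (i , _ , u) = bracket α 0 ; j = ℤ.suc (ℤ.suc i)
      in n ^ℤ j + 1ℚ , n ^ℤ j , j , 0 , m<m+ε (n ^ℤ j) 0<1 , ^ℤ-pos n j , u
         , ≤-reflexive (sym (*-identityʳ _))
  ; lower-closed    = λ { q<r (s , i , k , r<s , rest) → s , i , k , <-trans q<r r<s , rest }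
  ; upper-closed    = λ { q<r (s , i , k , s<q , rest) → s , i , k , <-trans s<q q<r , rest }
  ; lower-open      = λ { (s , i , k , q<s , rest) →
      let (t , q<t , t<s) = <-dense q<s in t , q<t , s , i , k , t<s , rest }
  ; upper-open      = λ { (s , i , k , s<q , rest) →
      let (t , s<t , t<q) = <-dense s<q in t , t<q , s , i , k , s<t , rest }
  ; disjoint        = disj
  ; located         = loc
  }
  where
  L U : ℚ → Set
  L q = ∃ λ s → ∃₂ λ i k → q < s × 0ℚ ≤ s × Lower α (i / suc k) × s ^ suc k ≤ n ^ℤ i
  U q = ∃ λ s → ∃₂ λ i k → s < q × 0ℚ < s × Upper α (i / suc k) × n ^ℤ i ≤ s ^ suc k

  below : ∀ {q} → q < 0ℚ → L q
  below q<0 = let (i , l , _) = bracket α 0 in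
    0ℚ , i , 0 , q<0 , ≤-refl , l , <⇒≤ (^ℤ-pos n i)

  disj : ∀ {q} → L q → U q → ⊥
  disj (s , i , k , q<s , 0≤s , l , h) (t , j , m , t<q , 0<t , u , g) = <-irrefl refl
    (begin-strict
      (t ^ suc k) ^ suc m         <⟨ ^-mono-< (^-nonNeg (<⇒≤ 0<t) (suc k)) (^-mono-< (<⇒≤ 0<t) (<-trans t<q q<s) k) m ⟩
      (s ^ suc k) ^ suc m         ≤⟨ ^-mono-≤ (^-nonNeg 0≤s (suc k)) h (suc m) ⟩
      (n ^ℤ i) ^ suc m            ≡⟨ ^ℤ-* n i m ⟩
      n ^ℤ (i ℤ.* + suc m)        ≤⟨ ^ℤ-mono n (ℤ.<⇒≤ (frac-cross-< {i} {j} k m (lower<upper α l u))) ⟩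
      n ^ℤ (j ℤ.* + suc k)        ≡⟨ sym (^ℤ-* n j k) ⟩
      (n ^ℤ j) ^ suc k            ≤⟨ ^-mono-≤ (<⇒≤ (^ℤ-pos n j)) g (suc k) ⟩
      (t ^ suc m) ^ suc k         ≡⟨ ^-swap t (suc m) (suc k) ⟩
      (t ^ suc k) ^ suc m         ∎)
    where open ≤-Reasoning

  loc : ∀ {q r} → q < r → L q ⊎ U r
  loc {q} {r} q<r with q <? 0ℚ
  ... | yes q<0 = inj₁ (below q<0)
  ... | no  q≮0 = go
    where
    mid = <-dense q<r
    t   = proj₁ mid
    t<r = proj₂ (proj₂ mid)
    mid′ = <-dense (proj₁ (proj₂ mid))
    s   = proj₁ mid′
    q<s = proj₁ (proj₂ mid′)
    s<t = proj₂ (proj₂ mid′)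
    0<s : 0ℚ < s
    0<s = ≤-<-trans (≮⇒≥ q≮0) q<s
    ρ = proj₁ (divide t 0<s)
    ρs≡t : ρ * s ≡ t
    ρs≡t = proj₂ (divide t 0<s)
    1<ρ : 1ℚ < ρ
    1<ρ = *-cancelʳ-< 0<s (subst₂ _<_ (sym (*-identityˡ s)) (sym ρs≡t) s<t)
    N = fromℕ n
    arch = archimedean 1<ρ (N * N)
    k = proj₁ arch
    go : L q ⊎ U r
    go = let (i , l , u) = bracket α k in split {i} l u ((s ^ suc k) ≤? (n ^ℤ i))
      where
      split : ∀ {i} → Lower α (i / suc k) → Upper α (ℤ.suc (ℤ.suc i) / suc k) →
              Dec (s ^ suc k ≤ n ^ℤ i) → L q ⊎ U r
      split {i} l u (yes h) = inj₁ (s , i , k , q<s , <⇒≤ 0<s , l , h)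
      split {i} l u (no  h) = inj₂ (t , ℤ.suc (ℤ.suc i) , k , t<r , <-trans 0<s s<t , u , (begin
        n ^ℤ ℤ.suc (ℤ.suc i)        ≡⟨ ^ℤ-suc n (ℤ.suc i) ⟩
        N * n ^ℤ ℤ.suc i            ≡⟨ cong (N *_) (^ℤ-suc n i) ⟩
        N * (N * n ^ℤ i)            ≡⟨ sym (*-assoc N N (n ^ℤ i)) ⟩
        (N * N) * n ^ℤ i            ≤⟨ *-mono-≤ (*-nonNeg 0≤N 0≤N) (^-nonNeg (<⇒≤ 0<s) (suc k)) (proj₂ arch) (<⇒≤ (≰⇒> h)) ⟩
        ρ ^ suc k * s ^ suc k       ≡⟨ sym (^-distrib-* ρ s (suc k)) ⟩
        (ρ * s) ^ suc k             ≡⟨ cong (_^ suc k) ρs≡t ⟩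
        t ^ suc k                   ∎))
        where
        open ≤-Reasoning
        0≤N : 0ℚ ≤ N
        0≤N = <⇒≤ (0<fromℕ n)

^ℝ-pos : ∀ n .{{_ : ℕ.NonZero n}} α → 0ℝ <ℝ n ^ℝ α
^ℝ-pos n α =
  let (i , l , _) = bracket α 0
      (q , 0<q , q<s) = <-dense (^ℤ-pos n i)
  in q , 0<q , n ^ℤ i , i , 0 , q<s , <⇒≤ (^ℤ-pos n i) , l , ≤-reflexive (*-identityʳ _)

record Graph (n : ℕ) : Set₁ where
  infix 4 _~_ _~?_
  field
    _~_    : Rel (Fin n) 0ℓ
    _~?_   : Decidable _~_
    symm   : Symmetric _~_
    irrefl : Irreflexive _≡_ _~_

module _ {n} (G : Graph n) where
  open Graph G

  neighbours : Fin n → Subset n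
  neighbours u = tabulate λ v → does (u ~? v)

  degree : Fin n → ℕ
  degree u = ∣ neighbours u ∣

  Regular : Set
  Regular = ∀ u v → degree u ≡ degree v

  -- C is a class of the reachability relation; the component itself is the
  -- subgraph induced on C.
  IsComponent : Subset n → Set
  IsComponent C = Nonempty C × (∀ {u} → u ∈ C → ∀ v → v ∈ C ⇔ Star _~_ u v)

  -- Each undirected edge occurs once, oriented from its smaller endpoint.
  record Edge : Set where
    constructor edge
    field
      src tgt  : Fin n
      ordered  : src <ᶠ tgt
      adjacent : src ~ tgt

  edges : List Edge
  edges = mapMaybe toEdge (cartesianProduct (allFin n) (allFin n))
    where
    toEdge : Fin n × Fin n → Maybe Edge
    toEdge (u , v) = Maybe.map (λ (u<v , u~v) → edge u v u<v u~v)
                               (dec⇒maybe ((u <ᶠ? v) ×-dec (u ~? v)))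

  degree-nonZero : ∀ {u v} → u ~ v → ℕ.NonZero (degree u)
  degree-nonZero {u} {v} u~v = ℕ.>-nonZero (ℕ.≤-<-trans ℕ.z≤n (x∈p⇒∣p-x∣<∣p∣ v∈N))
    where
    v∈N : v ∈ neighbours u
    v∈N = lookup⇒[]= v (neighbours u)
            (trans (lookup∘tabulate (λ w → does (u ~? w)) v) (dec-true (u ~? v) u~v))

  sddTerm : ℝ → Edge → ℝ
  sddTerm α e = a ÷ℝ b +ℝ b ÷ℝ a
    where
    open Edge e
    instance
      src≢0 = degree-nonZero adjacent
      tgt≢0 = degree-nonZero (symm adjacent)
    a b : ℝ⁺
    a = degree src ^ℝ α , ^ℝ-pos (degree src) α
    b = degree tgt ^ℝ α , ^ℝ-pos (degree tgt) α

  SDD : ℝ → ℝ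
  SDD α = foldr _+ℝ_ 0ℝ (List.map (sddTerm α) edges)

-- Used to renumber the vertices of an induced subgraph, in increasing order.
embed : ∀ {n} (C : Subset n) → Fin ∣ C ∣ → Fin n
embed (inside  ∷ C) zero    = zero
embed (inside  ∷ C) (suc i) = suc (embed C i)
embed (outside ∷ C) i       = suc (embed C i)

induced : ∀ {n} → Graph n → (C : Subset n) → Graph ∣ C ∣
induced G C = record
  { _~_    = λ i j → embed C i ~ embed C j
  ; _~?_   = λ i j → embed C i ~? embed C j
  ; symm   = symm
  ; irrefl = λ { refl → irrefl refl }
  }
  where open Graph G

{-# OPTIONS --safe #-}

-- For an edge whose end degrees are a < b put z(γ) = b ^ γ / a ^ γ, so that its
-- term is z(γ) + 1 / z(γ).  Since t + 1 / t is strictly increasing for t ≥ 1 and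
-- z(γ) > 1 for γ > 0, it suffices to find rationals 1 ≤ t < t′ with
-- z(α) ≤ t and t′ ≤ z(β).  Between α and β there are rationals i / k and
-- (i + 1) / k, and consecutive powers of some ρ slightly above 1 serve as t and
-- t′ with (b / a) ^ i ≤ t ^ k and t′ ^ k ≤ (b / a) ^ (i + 1).  If a = b the term
-- does not depend on γ, so equality of the sums means that adjacent vertices
-- have equal degrees, i.e. that the degree is constant on each component.
module Submission where

open import Defs
open import Data.Empty using (⊥; ⊥-elim)
open import Data.Product using (∃; ∃₂; _×_; _,_; proj₁; proj₂)
open import Data.Sum using (_⊎_; inj₁; inj₂; fromInj₁; fromInj₂)
open import Data.Nat as ℕ using (ℕ; zero; suc)
import Data.Nat.Properties as ℕ
open import Data.Integer as ℤ using (ℤ; +_; -[1+_])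
import Data.Integer.Properties as ℤ
open import Data.Rational hiding (∣_∣)
open import Data.Rational.Properties
open import Tactic.RingSolver using (solve-∀)
open import Algebra.Bundles using (CommutativeRing)
open import Algebra.Properties.CommutativeSemiring.Exp
  (CommutativeRing.commutativeSemiring +-*-commutativeRing)
  using (_^_; ^-distrib-*; ^-homo-*)
open import Data.Bool using (Bool; true; false)
open import Data.Fin using (Fin; zero; suc) renaming (_<_ to _<ᶠ_)
open import Data.Fin.Properties using () renaming (<-cmp to <ᶠ-cmp; _<?_ to _<ᶠ?_)
open import Data.Fin.Subset using (Subset; inside; outside; ∣_∣; _∈_)
open import Data.Fin.Subset.Properties using (drop-there)
open import Data.Vec using ([]; _∷_; tabulate; here; there)
open import Data.Vec.Properties using (lookup⇒[]=; []=⇒lookup; lookup∘tabulate)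
open import Data.List as List using (List; []; _∷_; cartesianProduct; allFin; foldr)
open import Data.List.Membership.Propositional using (lose)
open import Data.List.Membership.Propositional.Properties using (∈-allFin; ∈-cartesianProduct⁺)
open import Data.List.Relation.Unary.Any as Any using (Any; here; there)
open import Data.List.Relation.Unary.Any.Properties using (map⁺; mapMaybe⁺)
import Data.Maybe as Maybe
import Data.Maybe.Relation.Unary.Any as MaybeAny
open import Relation.Nullary using (¬_; Dec; yes; no; does; contradiction)
open import Relation.Nullary.Decidable using (dec-true; dec⇒maybe; decidable-stable; _×-dec_;
  ¬¬-excluded-middle)
open import Relation.Binary.Construct.Closure.ReflexiveTransitive using (ε; _◅_; _◅◅_; reverse; fold)
open import Function using (_⇔_; mk⇔; Equivalence)
open import Relation.Binary using (Tri; tri<; tri≈; tri>)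
open import Relation.Binary.PropositionalEquality

open ℝ

-- Inequalities between rationals: `t + 1 / t`, approximate roots, powers.

private
  expand : ∀ s t s′ t′ →
    t + s + (t′ - t) * (1ℚ - s * s′) ≡ t′ + (s - s′ * t′ * s) + s * t * s′
  expand = solve-∀ ℚ-ring

  cancel-units : ∀ s s′ t′ → t′ + (s - 1ℚ * s) + 1ℚ * s′ ≡ t′ + s′
  cancel-units = solve-∀ ℚ-ring

  interchange : ∀ s t s′ t′ → s * s′ * (t * t′) ≡ s * t * (s′ * t′)
  interchange = solve-∀ ℚ-ring

  c*d*b : ∀ c d b → d * (c * b) ≡ c * d * b
  c*d*b = solve-∀ ℚ-ring

  x*[y*z] : ∀ x y z → x * (y * z) ≡ y * (x * z)
  x*[y*z] = solve-∀ ℚ-ring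

*-increasingˡ : ∀ {a b} → 1ℚ ≤ a → 0ℚ ≤ b → b ≤ a * b
*-increasingˡ {a} {b} 1≤a 0≤b = subst (_≤ a * b) (*-identityˡ b) (*-monoʳ-≤ 0≤b 1≤a)

-- The difference of the two sides is (t′ - t) (1 - s s′).
t+1/t-mono-< : ∀ s t s′ t′ → 1ℚ ≤ t → t < t′ → s * t ≡ 1ℚ → s′ * t′ ≡ 1ℚ → t + s < t′ + s′
t+1/t-mono-< s t s′ t′ 1≤t t<t′ st≡1 s′t′≡1 = subst (t + s <_) eq
  (m<m+ε (t + s) (*-pos (<⇒0<- t<t′) (<⇒0<- ss′<1)))
  where
  1<t′ : 1ℚ < t′
  1<t′ = ≤-<-trans 1≤t t<t′
  0<t′ : 0ℚ < t′
  0<t′ = <-trans 0<1 1<t′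
  1<tt′ : 1ℚ < t * t′
  1<tt′ = <-≤-trans 1<t′ (*-increasingˡ 1≤t (<⇒≤ 0<t′))
  ss′<1 : s * s′ < 1ℚ
  ss′<1 = *-cancelʳ-< (<-trans 0<1 1<tt′) (subst₂ _<_
    (sym (trans (interchange s t s′ t′) (cong₂ _*_ st≡1 s′t′≡1)))
    (sym (*-identityˡ (t * t′))) 1<tt′)
  eq : t + s + (t′ - t) * (1ℚ - s * s′) ≡ t′ + s′
  eq = trans (expand s t s′ t′)
    (trans (cong₂ (λ x y → t′ + (s - x * s) + y * s′) s′t′≡1 st≡1) (cancel-units s s′ t′))

-- By induction: `r` is split as `τ * σ` with both factors above 1. The smaller of `τ` and a
-- rational whose `n`-th power is at most `σ` then serves for `suc n`.
root>1 : ∀ n {r} → 1ℚ < r → ∃ λ ρ → 1ℚ < ρ × ρ ^ n ≤ r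
root>1 zero {r} 1<r = r , 1<r , <⇒≤ 1<r
root>1 (suc n) {r} 1<r =
  let (σ , 1<σ , σ<r) = <-dense 1<r
      0<σ = <-trans 0<1 1<σ
      (τ , τσ≡r) = divide r 0<σ
      1<τ = *-cancelʳ-< 0<σ (subst₂ _<_ (sym (*-identityˡ σ)) (sym τσ≡r) σ<r)
      (ρ , 1<ρ , ρⁿ≤σ) = root>1 n 1<σ
      0≤ : ∀ {a} → 1ℚ < a → 0ℚ ≤ a
      0≤ = λ 1<a → <⇒≤ (<-trans 0<1 1<a)
      pick : ρ ≤ τ ⊎ τ ≤ ρ → ∃ λ ρ′ → 1ℚ < ρ′ × ρ′ ^ suc n ≤ r
      pick = λ where
        (inj₁ ρ≤τ) → ρ , 1<ρ , subst (ρ ^ suc n ≤_) τσ≡r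
          (*-mono-≤ (0≤ 1<ρ) (0≤ 1<σ) ρ≤τ ρⁿ≤σ)
        (inj₂ τ≤ρ) → τ , 1<τ , subst (τ ^ suc n ≤_) τσ≡r
          (*-monoˡ-≤ (0≤ 1<τ) (≤-trans (^-mono-≤ (0≤ 1<τ) τ≤ρ n) ρⁿ≤σ))
  in pick (≤-total ρ τ)

-- Descending from `M` while the next lower power still bounds `c` stops at a power that overshoots
-- `c` by at most one factor `σ`.
geometric-step : ∀ {σ c} → 1ℚ ≤ σ → 1ℚ ≤ c → ∀ M → c ≤ σ ^ M →
  ∃ λ m → c ≤ σ ^ m × σ ^ m ≤ σ * c
geometric-step 1≤σ 1≤c zero h =
  0 , h , ≤-trans 1≤c (*-increasingˡ 1≤σ (≤-trans (<⇒≤ 0<1) 1≤c))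
geometric-step {σ} {c} 1≤σ 1≤c (suc M) h with c ≤? σ ^ M
... | yes c≤ = geometric-step 1≤σ 1≤c M c≤
... | no  c≰ = suc M , h , *-monoˡ-≤ (≤-trans (<⇒≤ 0<1) 1≤σ) (<⇒≤ (≰⇒> c≰))

-- t and t′ are consecutive powers of some ρ > 1 with ρ ^ 2 (k + 1) ≤ r.
separating-roots : ∀ {r} → 1ℚ < r → ∀ i k → ∃₂ λ t t′ →
  1ℚ ≤ t × t < t′ × r ^ i ≤ t ^ suc k × t′ ^ suc k ≤ r ^ suc i
separating-roots {r} 1<r i k =
  let K = suc k
      -- Two factors `σ = ρ ^ K` must fit into `r`: one for the overshoot of `σ ^ m` over `r ^ i`,
      -- one for the passage from `t` to `t′`.
      (ρ , 1<ρ , ρ²ᴷ≤r) = root>1 (K ℕ.+ K) 1<r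
      1≤ρ = <⇒≤ 1<ρ
      0≤ρ = ≤-trans (<⇒≤ 0<1) 1≤ρ
      σ = ρ ^ K
      1≤σ = 1≤^ 1≤ρ K
      0≤σ = ≤-trans (<⇒≤ 0<1) 1≤σ
      1≤rⁱ = 1≤^ (<⇒≤ 1<r) i
      (M , rⁱ≤ρᴹ) = archimedean 1<ρ (r ^ i)
      rⁱ≤σᴹ = ≤-trans rⁱ≤ρᴹ (^-mono-≤ 0≤ρ
        (subst (_≤ σ) (*-identityʳ ρ) (*-monoˡ-≤ 0≤ρ (1≤^ 1≤ρ k))) (suc M))
      (m , lo , hi) = geometric-step 1≤σ 1≤rⁱ (suc M) rⁱ≤σᴹ
      open ≤-Reasoning
  in ρ ^ m , ρ ^ suc m , 1≤^ 1≤ρ m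
     , subst (_< ρ ^ suc m) (*-identityˡ (ρ ^ m))
         (*-monoʳ-< (^-pos (<-trans 0<1 1<ρ) m) 1<ρ)
     , subst (r ^ i ≤_) (^-swap ρ K m) lo
     , (begin
        (ρ ^ suc m) ^ K        ≡⟨ ^-swap ρ (suc m) K ⟩
        σ * σ ^ m              ≤⟨ *-monoˡ-≤ 0≤σ hi ⟩
        σ * (σ * r ^ i)        ≡⟨ sym (*-assoc σ σ (r ^ i)) ⟩
        σ * σ * r ^ i          ≡⟨ cong (_* r ^ i) (sym (^-homo-* ρ K K)) ⟩
        ρ ^ (K ℕ.+ K) * r ^ i  ≤⟨ *-monoʳ-≤ (≤-trans (<⇒≤ 0<1) 1≤rⁱ) ρ²ᴷ≤r ⟩
        r * r ^ i              ∎)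

-- Common denominators and integer exponents.

common-denominator : ∀ {p q} → 0ℚ ≤ p → p < q → ∃₂ λ i k →
  p ≤ + i / suc k × + suc i / suc k ≤ q
common-denominator {mkℚ -[1+ _ ] _ _} (*≤* ()) _
common-denominator {p@(mkℚ (+ n) d _)} {q@(mkℚ j e _)} _ (*<* h) =
  -- The second component is the predecessor of `suc d * suc e`. Over this denominator `p` is
  -- represented exactly, and `p < q` between integer numerators leaves room for one more unit.
  n ℕ.* suc e , e ℕ.+ d ℕ.* suc e
  , frac-≥ (+ (n ℕ.* suc e)) (e ℕ.+ d ℕ.* suc e) p
      (ℤ.≤-reflexive (trans (sym (ℤ.pos-* n (suc d ℕ.* suc e)))
        (trans (cong +_ (trans (cong (n ℕ.*_) (ℕ.*-comm (suc d) (suc e)))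
                               (sym (ℕ.*-assoc n (suc e) (suc d)))))
               (ℤ.pos-* (n ℕ.* suc e) (suc d)))))
  , frac-≤ (+ suc (n ℕ.* suc e)) (e ℕ.+ d ℕ.* suc e) q
      (subst (+ suc (n ℕ.* suc e) ℤ.* + suc e ℤ.≤_)
        (trans (ℤ.*-assoc j (+ suc d) (+ suc e)) (cong (j ℤ.*_) (sym (ℤ.pos-* (suc d) (suc e)))))
        (ℤ.*-monoʳ-≤-nonNeg (+ suc e)
          (ℤ.i<j⇒suc[i]≤j (subst (ℤ._< j ℤ.* + suc d) (sym (ℤ.pos-* n (suc e))) h))))

i<j⇒j≡i+suc : ∀ {i j} → i ℤ.< j → ∃ λ n → j ≡ i ℤ.+ + suc n
i<j⇒j≡i+suc {i} {j} i<j = n , (begin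
    j                                ≡⟨ sym (ℤ.+-identityˡ j) ⟩
    + 0 ℤ.+ j                        ≡⟨ cong (ℤ._+ j) (sym (ℤ.+-inverseʳ s)) ⟩
    s ℤ.- s ℤ.+ j                    ≡⟨ ℤ.+-assoc s (ℤ.- s) j ⟩
    s ℤ.+ (ℤ.- s ℤ.+ j)              ≡⟨ cong (λ z → s ℤ.+ z) (ℤ.+-comm (ℤ.- s) j) ⟩
    s ℤ.+ (j ℤ.- s)                  ≡⟨ cong (λ z → s ℤ.+ z) (sym (ℤ.0≤i⇒+∣i∣≡i (ℤ.i≤j⇒0≤j-i (ℤ.i<j⇒suc[i]≤j i<j)))) ⟩
    + 1 ℤ.+ i ℤ.+ + n                ≡⟨ cong (ℤ._+ + n) (ℤ.+-comm (+ 1) i) ⟩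
    i ℤ.+ + 1 ℤ.+ + n                ≡⟨ ℤ.+-assoc i (+ 1) (+ n) ⟩
    i ℤ.+ + suc n                    ∎)
  where
  open ≡-Reasoning
  s = ℤ.suc i
  n = ℤ.∣ j ℤ.- s ∣

^ℤ-+ : ∀ n .{{_ : ℕ.NonZero n}} i m → n ^ℤ (i ℤ.+ + m) ≡ n ^ℤ i * fromℕ n ^ m
^ℤ-+ n i zero    = trans (cong (n ^ℤ_) (ℤ.+-identityʳ i)) (sym (*-identityʳ (n ^ℤ i)))
^ℤ-+ n i (suc m) = begin
  n ^ℤ (i ℤ.+ + suc m)               ≡⟨ cong (n ^ℤ_) (trans (ℤ.+-comm i (+ suc m)) (trans (ℤ.+-assoc (+ 1) (+ m) i) (cong ℤ.suc (ℤ.+-comm (+ m) i)))) ⟩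
  n ^ℤ ℤ.suc (i ℤ.+ + m)             ≡⟨ ^ℤ-suc n (i ℤ.+ + m) ⟩
  fromℕ n * n ^ℤ (i ℤ.+ + m)         ≡⟨ cong (fromℕ n *_) (^ℤ-+ n i m) ⟩
  fromℕ n * (n ^ℤ i * fromℕ n ^ m)   ≡⟨ x*[y*z] (fromℕ n) (n ^ℤ i) (fromℕ n ^ m) ⟩
  n ^ℤ i * (fromℕ n * fromℕ n ^ m)   ∎
  where open ≡-Reasoning

-- With r = b / a > 1, the hypotheses say r ^ (i / (k + 1)) ≤ t ≤ r ^ (j / (m + 1)),
-- stated without division.
root-ordered : ∀ a b .{{_ : ℕ.NonZero a}} .{{_ : ℕ.NonZero b}} → a ℕ.< b →
  ∀ {t} i k j m → 0ℚ ≤ t → j ℤ.* + suc k ℤ.< i ℤ.* + suc m →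
  b ^ℤ i ≤ t ^ suc k * a ^ℤ i → t ^ suc m * a ^ℤ j ≤ b ^ℤ j → ⊥
root-ordered a b a<b {t} i k j m 0≤t jk<im lo hi = <-irrefl refl (begin-strict
  b ^ℤ P * A ^ N                          <⟨ *-monoˡ-< (^ℤ-pos b P) (^-mono-< (<⇒≤ (0<fromℕ a)) (frac-mono-< 0 (ℤ.+<+ a<b)) n) ⟩
  b ^ℤ P * B ^ N                          ≡⟨ sym (^ℤ-+ b P N) ⟩
  b ^ℤ (P ℤ.+ + N)                        ≡⟨ cong (b ^ℤ_) (sym eq) ⟩
  b ^ℤ (i ℤ.* + suc m)                    ≡⟨ sym (^ℤ-* b i m) ⟩
  (b ^ℤ i) ^ suc m                        ≤⟨ ^-mono-≤ (<⇒≤ (^ℤ-pos b i)) lo (suc m) ⟩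
  (t ^ suc k * a ^ℤ i) ^ suc m            ≡⟨ ^-distrib-* (t ^ suc k) (a ^ℤ i) (suc m) ⟩
  (t ^ suc k) ^ suc m * (a ^ℤ i) ^ suc m  ≡⟨ cong₂ _*_ (^-swap t (suc k) (suc m)) (trans (^ℤ-* a i m) (trans (cong (a ^ℤ_) eq) (^ℤ-+ a P N))) ⟩
  T * (a ^ℤ P * A ^ N)                    ≡⟨ sym (*-assoc T (a ^ℤ P) (A ^ N)) ⟩
  T * a ^ℤ P * A ^ N                      ≡⟨ cong (λ x → T * x * A ^ N) (sym (^ℤ-* a j k)) ⟩
  T * (a ^ℤ j) ^ suc k * A ^ N            ≡⟨ cong (_* A ^ N) (sym (^-distrib-* (t ^ suc m) (a ^ℤ j) (suc k))) ⟩
  (t ^ suc m * a ^ℤ j) ^ suc k * A ^ N    ≤⟨ *-monoʳ-≤ (^-nonNeg (<⇒≤ (0<fromℕ a)) N) (^-mono-≤ 0≤tᵐaʲ hi (suc k)) ⟩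
  (b ^ℤ j) ^ suc k * A ^ N                ≡⟨ cong (_* A ^ N) (^ℤ-* b j k) ⟩
  b ^ℤ P * A ^ N                          ∎)
  where
  open ≤-Reasoning
  A = fromℕ a
  B = fromℕ b
  P = j ℤ.* + suc k
  -- The positive excess `N` of `i (m + 1)` over `P` is where `a < b` enters: `A ^ N < B ^ N` is the
  -- only strict step of the chain.
  n = proj₁ (i<j⇒j≡i+suc jk<im)
  N = suc n
  eq : i ℤ.* + suc m ≡ P ℤ.+ + N
  eq = proj₂ (i<j⇒j≡i+suc jk<im)
  T = (t ^ suc m) ^ suc k
  0≤tᵐaʲ : 0ℚ ≤ t ^ suc m * a ^ℤ j
  0≤tᵐaʲ = *-nonNeg (^-nonNeg 0≤t (suc m)) (<⇒≤ (^ℤ-pos a j))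

-- Order and addition of Dedekind reals.

-- Locatedness turns a refuted membership into a positive one, at the price of a strict gap between
-- `q` and `r`.
∉lower⇒upper : ∀ x {q r} → q < r → ¬ Lower x q → Upper x r
∉lower⇒upper x q<r q∉L = fromInj₂ (λ l → ⊥-elim (q∉L l)) (located x q<r)

∉upper⇒lower : ∀ x {q r} → q < r → ¬ Upper x r → Lower x q
∉upper⇒lower x q<r r∉U = fromInj₁ (λ u → ⊥-elim (r∉U u)) (located x q<r)

≤ℝ-refl : ∀ x → x ≤ℝ x
≤ℝ-refl _ _ l = l

<ℝ⇒≤ℝ : ∀ x y → x <ℝ y → x ≤ℝ y
<ℝ⇒≤ℝ x y (q , u , l) r m = lower-closed y (lower<upper x m u) l

<ℝ⇒≱ℝ : ∀ x y → x <ℝ y → ¬ (y ≤ℝ x)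
<ℝ⇒≱ℝ x y (q , u , l) y≤x = disjoint x (y≤x q l) u

-- `_≤ℝ_` mentions lower cuts only. Openness provides the gap that locatedness needs to carry it
-- over to upper cuts.
≤ℝ⇒upper : ∀ x y → x ≤ℝ y → ∀ {q} → Upper y q → Upper x q
≤ℝ⇒upper x y x≤y u =
  let (p , p<q , u′) = upper-open y u
  in ∉lower⇒upper x p<q (λ l → disjoint y (x≤y p l) u′)

<ℝ-≤ℝ-trans : ∀ x y z → x <ℝ y → y ≤ℝ z → x <ℝ z
<ℝ-≤ℝ-trans _ _ _ (q , u , l) y≤z = q , u , y≤z q l

≤ℝ-<ℝ-trans : ∀ x y z → x ≤ℝ y → y <ℝ z → x <ℝ z
≤ℝ-<ℝ-trans x y z x≤y (q , u , l) = q , ≤ℝ⇒upper x y x≤y u , l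

-- The bounds on the cuts are purely negative information. A point `w` strictly between `u` and `v`
-- leaves a gap on both sides, so it can be placed above `x` and below `y` by locatedness.
<ℝ-gap : ∀ x y {u v} →
  (∀ {q} → Lower x q → q < u) → u < v → (∀ {q} → Upper y q → v < q) → x <ℝ y
<ℝ-gap x y below u<v above =
  let (w , u<w , w<v) = <-dense u<v
  in w , ∉lower⇒upper x u<w (λ l → <-irrefl refl (below l))
       , ∉upper⇒lower y w<v (λ u → <-irrefl refl (above u))

+ℝ-comm-≤ : ∀ x y → (x +ℝ y) ≤ℝ (y +ℝ x)
+ℝ-comm-≤ x y q (a , b , l , m , h) = b , a , m , l , subst (q <_) (+-comm a b) h

+ℝ-mono-≤ : ∀ x x′ y y′ → x ≤ℝ x′ → y ≤ℝ y′ → (x +ℝ y) ≤ℝ (x′ +ℝ y′)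
+ℝ-mono-≤ _ _ _ _ x≤x′ y≤y′ q (a , b , l , m , h) = a , b , x≤x′ a l , y≤y′ b m , h

private
  p+[a+[q-p]] : ∀ p q a → p + (a + (q - p)) ≡ q + a
  p+[a+[q-p]] = solve-∀ ℚ-ring

-- Between `x` and `x′` there is a gap from `p` to `q`. Approximating `y` to within `q - p` ensures
-- `p + b < q + a`.
+ℝ-mono-<-≤ : ∀ x x′ y y′ → x <ℝ x′ → y ≤ℝ y′ → (x +ℝ y) <ℝ (x′ +ℝ y′)
+ℝ-mono-<-≤ x x′ y y′ (q , u , l) y≤y′ =
  let (p , p<q , u′) = upper-open x u
      (a , b , m , v , b<a+) = approx y (<⇒0<- p<q)
      (w , pb<w , w<qa) = <-dense (subst (p + b <_) (p+[a+[q-p]] p q a) (+-monoʳ-< p b<a+))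
  in w , (p , b , u′ , v , pb<w) , (q , a , l , y≤y′ a m , w<qa)

+ℝ-mono-≤-< : ∀ x x′ y y′ → x ≤ℝ x′ → y <ℝ y′ → (x +ℝ y) <ℝ (x′ +ℝ y′)
+ℝ-mono-≤-< x x′ y y′ x≤x′ y<y′ =
  ≤ℝ-<ℝ-trans (x +ℝ y) (y +ℝ x) (x′ +ℝ y′) (+ℝ-comm-≤ x y)
    (<ℝ-≤ℝ-trans (y +ℝ x) (y′ +ℝ x′) (x′ +ℝ y′)
      (+ℝ-mono-<-≤ y y′ x x′ y<y′ x≤x′) (+ℝ-comm-≤ y′ x′))

-- Quotients, and the sum of a quotient and its reciprocal.

-- Both quotients are 1: a member of the left lower cut is below 1, and no `r < 1` is in the upper
-- cut of `y ÷ℝ y`.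
÷ℝ-self-≤ : ∀ x y → (x ÷ℝ x) ≤ℝ (y ÷ℝ y)
÷ℝ-self-≤ x⁺@(x , _) y⁺@(y , 0<y) q (a , b , l , u , qb<a) =
  let (r , q<r , r<1) = <-dense q<1
  in ∉upper⇒lower (y⁺ ÷ℝ y⁺) q<r λ (a , b , u , l , 0<b , a<rb) → <-irrefl refl
       (<-trans (lower<upper y l u) (<-trans a<rb
         (subst (r * b <_) (*-identityˡ b) (*-monoʳ-< 0<b r<1))))
  where
  0<b = lower<upper x (pos⇒lower x (proj₂ x⁺)) u
  q<1 : q < 1ℚ
  q<1 = *-cancelʳ-< 0<b (<-trans qb<a (subst (a <_) (sym (*-identityˡ b)) (lower<upper x l u)))

-- Half of `(x / y) (y / x) = 1` in terms of cuts. For `d ≥ 0` the witnesses chain as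
-- `d (c B) ≤ d B′ < A′ < B`; for `d < 0` the product is negative.
÷ℝ-lower-* : ∀ x y c d → 0ℚ < c → Lower (x ÷ℝ y) c → Lower (y ÷ℝ x) d → c * d < 1ℚ
÷ℝ-lower-* (x , _) (y , 0<y) c d 0<c (A , B , lA , uB , cB<A) (A′ , B′ , lA′ , uB′ , dB′<A′)
  with 0ℚ ≤? d
... | no  0≰d = <-trans (subst (c * d <_) (*-zeroʳ c) (*-monoˡ-< 0<c (≰⇒> 0≰d))) 0<1
... | yes 0≤d = *-cancelʳ-< (lower<upper y (pos⇒lower y 0<y) uB)
    (begin-strict
      c * d * B    ≡⟨ sym (c*d*b c d B) ⟩
      d * (c * B)  ≤⟨ *-monoˡ-≤ 0≤d (<⇒≤ (<-trans cB<A (lower<upper x lA uB′))) ⟩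
      d * B′       <⟨ dB′<A′ ⟩
      A′           <⟨ lower<upper y lA′ uB ⟩
      B            ≡⟨ sym (*-identityˡ B) ⟩
      1ℚ * B       ∎)
  where open ≤-Reasoning

÷ℝ-upper-* : ∀ x y c d → Upper (x ÷ℝ y) c → Upper (y ÷ℝ x) d → 1ℚ < c * d
÷ℝ-upper-* (x , _) (y , _) c d (A , B , uA , lB , 0<B , A<cB) (A′ , B′ , uA′ , lB′ , 0<B′ , A′<dB′) =
  *-cancelʳ-< 0<B (begin-strict
      1ℚ * B       ≡⟨ *-identityˡ B ⟩
      B            <⟨ B<dB′ ⟩
      d * B′       ≤⟨ *-monoˡ-≤ (<⇒≤ 0<d) (<⇒≤ (<-trans (lower<upper x lB′ uA) A<cB)) ⟩
      d * (c * B)  ≡⟨ c*d*b c d B ⟩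
      c * d * B    ∎)
  where
  open ≤-Reasoning
  B<dB′ : B < d * B′
  B<dB′ = <-trans (lower<upper y lB uA′) A′<dB′
  0<d : 0ℚ < d
  0<d = *-cancelʳ-< 0<B′ (subst (_< d * B′) (sym (*-zeroˡ B′)) (<-trans 0<B B<dB′))

-- Monotonicity of `t + 1 / t` is available only from 1 on, so `c₀` is first replaced by the larger
-- of `c₀` and 1, which is still in the lower cut. The other summand `d` is then below `1 / c`.
recip-sum-below : ∀ x y s t → Lower (x ÷ℝ y) 1ℚ → ¬ Lower (x ÷ℝ y) t → s * t ≡ 1ℚ →
  ∀ {q} → Lower (x ÷ℝ y +ℝ y ÷ℝ x) q → q < t + s
recip-sum-below x y s t 1∈L t∉L st≡1 {q} (c₀ , d , c₀∈L , d∈L , q<c₀+d) =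
  go (≤-total c₀ 1ℚ)
  where
  from : ∀ {c} → 1ℚ ≤ c → Lower (x ÷ℝ y) c → c₀ ≤ c → q < t + s
  from {c} 1≤c c∈L c₀≤c =
    let 0<c = <-≤-trans 0<1 1≤c
        (e , ec≡1) = divide 1ℚ 0<c
        d<e = *-cancelʳ-< 0<c (subst₂ _<_ (*-comm c d) (sym ec≡1) (÷ℝ-lower-* x y c d 0<c c∈L d∈L))
        c<t = ≰⇒> (λ t≤c → t∉L (lower-≤ (x ÷ℝ y) t≤c c∈L))
    in <-trans q<c₀+d (≤-<-trans (+-monoˡ-≤ d c₀≤c)
         (<-trans (+-monoʳ-< c d<e) (t+1/t-mono-< e c s t 1≤c c<t ec≡1 st≡1)))
  go : c₀ ≤ 1ℚ ⊎ 1ℚ ≤ c₀ → q < t + s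
  go (inj₁ c₀≤1) = from ≤-refl 1∈L c₀≤1
  go (inj₂ 1≤c₀) = from 1≤c₀ c₀∈L ≤-refl

recip-sum-above : ∀ x y s t → 1ℚ ≤ t → ¬ Upper (x ÷ℝ y) t → s * t ≡ 1ℚ →
  ∀ {q} → Upper (x ÷ℝ y +ℝ y ÷ℝ x) q → t + s < q
recip-sum-above x y s t 1≤t t∉U st≡1 (c , d , c∈U , d∈U , c+d<q) =
  let t<c = ≰⇒> (λ c≤t → t∉U (upper-≤ (x ÷ℝ y) c≤t c∈U))
      0<c = <-trans (<-≤-trans 0<1 1≤t) t<c
      (e , ec≡1) = divide 1ℚ 0<c
      e<d = *-cancelʳ-< 0<c (subst₂ _<_ (sym ec≡1) (*-comm c d) (÷ℝ-upper-* x y c d c∈U d∈U))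
  in <-trans (t+1/t-mono-< s t e c 1≤t t<c st≡1 ec≡1) (<-trans (+-monoʳ-< c e<d) c+d<q)

-- Real powers and the ratio of two of them.

-- Otherwise `s` itself would witness that a slightly larger member of the lower cut is also in the
-- upper cut.
^ℝ-lower : ∀ n .{{_ : ℕ.NonZero n}} γ {s} i k → 0ℚ < s →
  Lower (n ^ℝ γ) s → Upper γ (i / suc k) → s ^ suc k < n ^ℤ i
^ℝ-lower n γ {s} i k 0<s l u = ≰⇒> λ nⁱ≤sᵏ →
  let (s₁ , s<s₁ , l₁) = lower-open (n ^ℝ γ) l
  in disjoint (n ^ℝ γ) l₁ (s , i , k , s<s₁ , 0<s , u , nⁱ≤sᵏ)

^ℝ-upper : ∀ n .{{_ : ℕ.NonZero n}} γ {s} i k →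
  Upper (n ^ℝ γ) s → Lower γ (i / suc k) → n ^ℤ i < s ^ suc k
^ℝ-upper n γ {s} i k u l = ≰⇒> λ sᵏ≤nⁱ →
  let (s₁ , s₁<s , u₁) = upper-open (n ^ℝ γ) u
      0<s₁ = lower<upper (n ^ℝ γ) (pos⇒lower (n ^ℝ γ) (^ℝ-pos n γ)) u₁
  in disjoint (n ^ℝ γ)
       (s , i , k , s₁<s , <⇒≤ (<-trans 0<s₁ s₁<s) , l , sᵏ≤nⁱ) u₁

infix 9 _^⁺_

_^⁺_ : ∀ n .{{_ : ℕ.NonZero n}} → ℝ → ℝ⁺
n ^⁺ γ = n ^ℝ γ , ^ℝ-pos n γ

module _ (a b : ℕ) .{{_ : ℕ.NonZero a}} .{{_ : ℕ.NonZero b}} (a<b : a ℕ.< b) where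

  -- The hypothesis puts `t` at or above `(b / a) ^ (i / (k + 1))`, with exponent above `γ`.
  -- Membership would put `t` at or below such a power with exponent `j / (m + 1)` below `γ`, which
  -- `root-ordered` excludes.
  ratio-∉-lower : ∀ γ {t} i k → 0ℚ ≤ t → Upper γ (i / suc k) →
    b ^ℤ i ≤ t ^ suc k * a ^ℤ i → ¬ Lower (b ^⁺ γ ÷ℝ a ^⁺ γ) t
  ratio-∉-lower γ {t} i k 0≤t γ<i/k lo (A , B , (s , j , m , A<s , 0≤s , j/m<γ , sᵐ≤bʲ) , uB , tB<A) =
    root-ordered a b a<b i k j m 0≤t (frac-cross-< {j} {i} m k (lower<upper γ j/m<γ γ<i/k)) lo
      (begin
        t ^ suc m * a ^ℤ j    ≤⟨ *-monoˡ-≤ (^-nonNeg 0≤t (suc m)) (<⇒≤ (^ℝ-upper a γ j m uB j/m<γ)) ⟩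
        t ^ suc m * B ^ suc m ≡⟨ sym (^-distrib-* t B (suc m)) ⟩
        (t * B) ^ suc m       ≤⟨ ^-mono-≤ (*-nonNeg 0≤t 0≤B) (<⇒≤ (<-trans tB<A A<s)) (suc m) ⟩
        s ^ suc m             ≤⟨ sᵐ≤bʲ ⟩
        b ^ℤ j                ∎)
    where
    open ≤-Reasoning
    0≤B : 0ℚ ≤ B
    0≤B = <⇒≤ (lower<upper (a ^ℝ γ) (pos⇒lower (a ^ℝ γ) (^ℝ-pos a γ)) uB)

  ratio-∉-upper : ∀ γ {t} i k → 0ℚ ≤ t → Lower γ (i / suc k) →
    t ^ suc k * a ^ℤ i ≤ b ^ℤ i → ¬ Upper (b ^⁺ γ ÷ℝ a ^⁺ γ) t
  ratio-∉-upper γ {t} i k 0≤t i/k<γ hi (A , B , (s , j , m , s<A , 0<s , γ<j/m , bʲ≤sᵐ) , lB , 0<B , A<tB) =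
    root-ordered a b a<b j m i k 0≤t (frac-cross-< {i} {j} k m (lower<upper γ i/k<γ γ<j/m))
      (begin
        b ^ℤ j                ≤⟨ bʲ≤sᵐ ⟩
        s ^ suc m             ≤⟨ ^-mono-≤ (<⇒≤ 0<s) (<⇒≤ (<-trans s<A A<tB)) (suc m) ⟩
        (t * B) ^ suc m       ≡⟨ ^-distrib-* t B (suc m) ⟩
        t ^ suc m * B ^ suc m ≤⟨ *-monoˡ-≤ (^-nonNeg 0≤t (suc m)) (<⇒≤ (^ℝ-lower a γ j m 0<B lB γ<j/m)) ⟩
        t ^ suc m * a ^ℤ j    ∎)
      hi
    where open ≤-Reasoning

  -- The pair is fixed before `γ` is chosen, so that a single pair can be used for both `α` and `β`.
  ratio-separation : ∀ {p q} → 0ℚ ≤ p → p < q → ∃₂ λ t t′ → 1ℚ ≤ t × t < t′ ×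
    (∀ γ → Upper γ p → ¬ Lower (b ^⁺ γ ÷ℝ a ^⁺ γ) t) ×
    (∀ γ → Lower γ q → ¬ Upper (b ^⁺ γ ÷ℝ a ^⁺ γ) t′)
  ratio-separation {p} {q} 0≤p p<q =
    let (r , ra≡b) = divide (fromℕ b) 0<A
        1<r = *-cancelʳ-< 0<A (subst₂ _<_ (sym (*-identityˡ (fromℕ a))) (sym ra≡b)
                (frac-mono-< 0 (ℤ.+<+ a<b)))
        rⁱaⁱ≡bⁱ : ∀ i → r ^ i * fromℕ a ^ i ≡ fromℕ b ^ i
        rⁱaⁱ≡bⁱ = λ i → trans (sym (^-distrib-* r (fromℕ a) i)) (cong (_^ i) ra≡b)
        0≤Aⁱ : ∀ i → 0ℚ ≤ fromℕ a ^ i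
        0≤Aⁱ = λ i → ^-nonNeg (<⇒≤ 0<A) i
        (i , k , p≤i/k , i+1/k≤q) = common-denominator 0≤p p<q
        (t , t′ , 1≤t , t<t′ , lo , hi) = separating-roots 1<r i k
        0≤t = ≤-trans (<⇒≤ 0<1) 1≤t
    in t , t′ , 1≤t , t<t′
       , (λ γ γ<p → ratio-∉-lower γ (+ i) k 0≤t (upper-≤ γ p≤i/k γ<p)
            (subst (_≤ t ^ suc k * fromℕ a ^ i) (rⁱaⁱ≡bⁱ i) (*-monoʳ-≤ (0≤Aⁱ i) lo)))
       , (λ γ q<γ → ratio-∉-upper γ (+ suc i) k (≤-trans 0≤t (<⇒≤ t<t′)) (lower-≤ γ i+1/k≤q q<γ)
            (subst (t′ ^ suc k * fromℕ a ^ suc i ≤_) (rⁱaⁱ≡bⁱ (suc i)) (*-monoʳ-≤ (0≤Aⁱ (suc i)) hi)))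
    where
    0<A : 0ℚ < fromℕ a
    0<A = 0<fromℕ a

  1∈ratio : ∀ γ → 0ℝ <ℝ γ → Lower (b ^⁺ γ ÷ℝ a ^⁺ γ) 1ℚ
  1∈ratio γ (q , 0<q , q<γ) =
    -- Separation between the exponents 0 and `q` gives `1 < t′` with `t′` not above the ratio.
    let (_ , t′ , 1≤t , t<t′ , _ , t′∉U) = ratio-separation ≤-refl 0<q
    in ∉upper⇒lower (b ^⁺ γ ÷ℝ a ^⁺ γ) (≤-<-trans 1≤t t<t′) (t′∉U γ q<γ)

  recip-sum-< : ∀ α β → 0ℝ <ℝ α → α <ℝ β →
    (b ^⁺ α ÷ℝ a ^⁺ α +ℝ a ^⁺ α ÷ℝ b ^⁺ α) <ℝ (b ^⁺ β ÷ℝ a ^⁺ β +ℝ a ^⁺ β ÷ℝ b ^⁺ β)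
  recip-sum-< α β 0<α (p , α<p , p<β) =
    -- Openness of `β` supplies the second rational, so that `α < p < q < β`.
    let (q , p<q , q<β) = lower-open β p<β
        (t , t′ , 1≤t , t<t′ , t∉L , t′∉U) =
          ratio-separation (<⇒≤ (lower<upper α (pos⇒lower α 0<α) α<p)) p<q
        1≤t′ = ≤-trans 1≤t (<⇒≤ t<t′)
        (s , st≡1) = divide 1ℚ (<-≤-trans 0<1 1≤t)
        (s′ , s′t′≡1) = divide 1ℚ (<-≤-trans 0<1 1≤t′)
    in <ℝ-gap
         (b ^⁺ α ÷ℝ a ^⁺ α +ℝ a ^⁺ α ÷ℝ b ^⁺ α) (b ^⁺ β ÷ℝ a ^⁺ β +ℝ a ^⁺ β ÷ℝ b ^⁺ β)
         (recip-sum-below (b ^⁺ α) (a ^⁺ α) s t (1∈ratio α 0<α) (t∉L α α<p) st≡1)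
         (t+1/t-mono-< s t s′ t′ 1≤t t<t′ st≡1 s′t′≡1)
         (recip-sum-above (b ^⁺ β) (a ^⁺ β) s′ t′ 1≤t′ (t′∉U β q<β) s′t′≡1)

-- Edge terms as functions of two degrees.

-- This unfolds to `sddTerm` when `a` and `b` are the end degrees. With variables in their place,
-- `a ≡ b` can be matched with `refl`.
symmetricRatio : ∀ a b .{{_ : ℕ.NonZero a}} .{{_ : ℕ.NonZero b}} → ℝ → ℝ
symmetricRatio a b γ = a ^⁺ γ ÷ℝ b ^⁺ γ +ℝ b ^⁺ γ ÷ℝ a ^⁺ γ

symmetricRatio-< : ∀ a b .{{_ : ℕ.NonZero a}} .{{_ : ℕ.NonZero b}} α β → 0ℝ <ℝ α → α <ℝ β →
  a ≢ b → symmetricRatio a b α <ℝ symmetricRatio a b β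
symmetricRatio-< a b α β 0<α α<β a≢b with ℕ.<-cmp a b
... | tri≈ _ a≡b _ = ⊥-elim (a≢b a≡b)
... | tri> _ _ b<a = recip-sum-< b a b<a α β 0<α α<β
... | tri< a<b _ _ =
  ≤ℝ-<ℝ-trans (symmetricRatio a b α) (symmetricRatio b a α) (symmetricRatio a b β)
    (+ℝ-comm-≤ (a ^⁺ α ÷ℝ b ^⁺ α) (b ^⁺ α ÷ℝ a ^⁺ α))
    (<ℝ-≤ℝ-trans (symmetricRatio b a α) (symmetricRatio b a β) (symmetricRatio a b β)
      (recip-sum-< a b a<b α β 0<α α<β)
      (+ℝ-comm-≤ (b ^⁺ β ÷ℝ a ^⁺ β) (a ^⁺ β ÷ℝ b ^⁺ β)))

symmetricRatio-self : ∀ a .{{_ : ℕ.NonZero a}} α β → symmetricRatio a a α ≤ℝ symmetricRatio a a β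
symmetricRatio-self a α β =
  +ℝ-mono-≤ (a ^⁺ α ÷ℝ a ^⁺ α) (a ^⁺ β ÷ℝ a ^⁺ β) (a ^⁺ α ÷ℝ a ^⁺ α) (a ^⁺ β ÷ℝ a ^⁺ β)
    (÷ℝ-self-≤ (a ^⁺ α) (a ^⁺ β)) (÷ℝ-self-≤ (a ^⁺ α) (a ^⁺ β))

symmetricRatio-≡ : ∀ a b .{{_ : ℕ.NonZero a}} .{{_ : ℕ.NonZero b}} α β →
  a ≡ b → symmetricRatio a b α ≤ℝ symmetricRatio a b β
-- Both `NonZero` instances now concern `a`. They are irrelevant, hence interchangeable, and one is
-- passed explicitly.
symmetricRatio-≡ a .a {{a≢0}} α β refl = symmetricRatio-self a {{a≢0}} α β

-- Finite sums of reals.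

sumℝ : ∀ {A : Set} → (A → ℝ) → List A → ℝ
sumℝ f xs = foldr _+ℝ_ 0ℝ (List.map f xs)

sumℝ-mono-≤ : ∀ {A : Set} (f g : A → ℝ) → (∀ x → f x ≤ℝ g x) → ∀ xs → sumℝ f xs ≤ℝ sumℝ g xs
sumℝ-mono-≤ f g f≤g []       = ≤ℝ-refl 0ℝ
sumℝ-mono-≤ f g f≤g (x ∷ xs) =
  +ℝ-mono-≤ (f x) (g x) (sumℝ f xs) (sumℝ g xs) (f≤g x) (sumℝ-mono-≤ f g f≤g xs)

sumℝ-mono-< : ∀ {A : Set} (f g : A → ℝ) → (∀ x → f x ≤ℝ g x) →
  ∀ {xs} → Any (λ x → f x <ℝ g x) xs → sumℝ f xs <ℝ sumℝ g xs
sumℝ-mono-< f g f≤g {x ∷ xs} (here fx<gx) =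
  +ℝ-mono-<-≤ (f x) (g x) (sumℝ f xs) (sumℝ g xs) fx<gx (sumℝ-mono-≤ f g f≤g xs)
sumℝ-mono-< f g f≤g {x ∷ xs} (there any) =
  +ℝ-mono-≤-< (f x) (g x) (sumℝ f xs) (sumℝ g xs) (f≤g x) (sumℝ-mono-< f g f≤g any)

-- Finite double negation, subsets and their enumeration.

-- Double-negation shift, which holds constructively because the index set is finite.
¬¬-Π-Fin : ∀ {n} {P : Fin n → Set} → (∀ i → ¬ ¬ P i) → ¬ ¬ (∀ i → P i)
¬¬-Π-Fin {zero}  h k = k λ ()
¬¬-Π-Fin {suc n} h k = h zero λ p₀ → ¬¬-Π-Fin (λ i → h (suc i)) λ p →
  k λ { zero → p₀ ; (suc i) → p i }

embed-∈ : ∀ {n} (C : Subset n) i → embed C i ∈ C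
embed-∈ (inside  ∷ C) zero    = here
embed-∈ (inside  ∷ C) (suc i) = there (embed-∈ C i)
embed-∈ (outside ∷ C) i       = there (embed-∈ C i)

embed-surjective : ∀ {n} {C : Subset n} {v} → v ∈ C → ∃ λ i → embed C i ≡ v
embed-surjective {C = inside  ∷ C} here      = zero , refl
embed-surjective {C = inside  ∷ C} (there p) = let (i , eq) = embed-surjective p in suc i , cong suc eq
embed-surjective {C = outside ∷ C} (there p) = let (i , eq) = embed-surjective p in i , cong suc eq

-- The positions skipped by `embed` lie outside `C`, where `f` is false, so they add nothing to the
-- count.
∣tabulate-embed∣ : ∀ {n} (C : Subset n) (f : Fin n → Bool) → (∀ v → f v ≡ true → v ∈ C) →
  ∣ tabulate (λ i → f (embed C i)) ∣ ≡ ∣ tabulate f ∣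
∣tabulate-embed∣ []            f f⊆C = refl
∣tabulate-embed∣ (inside ∷ C)  f f⊆C with f zero
... | true  = cong suc (∣tabulate-embed∣ C (λ v → f (suc v)) (λ v p → drop-there (f⊆C (suc v) p)))
... | false = ∣tabulate-embed∣ C (λ v → f (suc v)) (λ v p → drop-there (f⊆C (suc v) p))
∣tabulate-embed∣ (outside ∷ C) f f⊆C with f zero in eq
... | true  = contradiction (f⊆C zero eq) λ ()
... | false = ∣tabulate-embed∣ C (λ v → f (suc v)) (λ v p → drop-there (f⊆C (suc v) p))

does-true : ∀ {A : Set} (a? : Dec A) → does a? ≡ true → A
does-true (yes a) _ = a

∈-tabulate-does⁺ : ∀ {n} {P : Fin n → Set} (P? : ∀ v → Dec (P v)) {v} →
  P v → v ∈ tabulate (λ w → does (P? w))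
∈-tabulate-does⁺ P? {v} p =
  lookup⇒[]= v _ (trans (lookup∘tabulate (λ w → does (P? w)) v) (dec-true (P? v) p))

∈-tabulate-does⁻ : ∀ {n} {P : Fin n → Set} (P? : ∀ v → Dec (P v)) {v} →
  v ∈ tabulate (λ w → does (P? w)) → P v
∈-tabulate-does⁻ P? {v} v∈ = does-true (P? v)
  (trans (sym (lookup∘tabulate (λ w → does (P? w)) v)) ([]=⇒lookup v∈))

-- The proof stored by the decision may differ from the given one, so `Q` is required for every
-- proof of `A`.
any-map-dec⇒maybe : ∀ {A B : Set} {Q : B → Set} (a? : Dec A) {f : A → B} → A → (∀ a → Q (f a)) →
  MaybeAny.Any Q (Maybe.map f (dec⇒maybe a?))
any-map-dec⇒maybe (yes a) _ q = MaybeAny.just (q a)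
any-map-dec⇒maybe (no ¬a) a _ = contradiction a ¬a

-- Degrees on components, and the equality case.

module _ {n} (G : Graph n) where
  open Graph G

  -- A component contains all neighbours of its vertices, so passing to the induced subgraph loses
  -- none of them.
  degree-induced : ∀ {C} → IsComponent G C → ∀ i → degree (induced G C) i ≡ degree G (embed C i)
  degree-induced {C} (_ , closed) i = ∣tabulate-embed∣ C (λ v → does (embed C i ~? v))
    λ v adj → Equivalence.from (closed (embed-∈ C i) v) (does-true (embed C i ~? v) adj ◅ ε)

  -- Reachability is decidable up to double negation, which is enough because
  -- equality of degrees is decidable.
  ¬¬-component : ∀ u → ¬ ¬ (∃ λ C → u ∈ C × IsComponent G C)
  ¬¬-component u k = ¬¬-Π-Fin (λ v → ¬¬-excluded-middle) λ reach? →
    k ( tabulate (λ v → does (reach? v))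
      , ∈-tabulate-does⁺ reach? ε
      , (u , ∈-tabulate-does⁺ reach? ε)
      , λ w∈C v → let u⇝w = ∈-tabulate-does⁻ reach? w∈C in mk⇔
          (λ v∈C → reverse symm u⇝w ◅◅ ∈-tabulate-does⁻ reach? v∈C)
          (λ w⇝v → ∈-tabulate-does⁺ reach? (u⇝w ◅◅ w⇝v)) )

  Balanced : Set
  Balanced = ∀ {u v} → u ~ v → degree G u ≡ degree G v

  balanced⇒regular : Balanced → ∀ C → IsComponent G C → Regular (induced G C)
  balanced⇒regular bal C comp@(_ , closed) i j = begin
    degree (induced G C) i    ≡⟨ degree-induced comp i ⟩
    degree G (embed C i)      ≡⟨ fold (λ u v → degree G u ≡ degree G v) (λ u~v → trans (bal u~v)) refl
                                   (Equivalence.to (closed (embed-∈ C i) (embed C j)) (embed-∈ C j)) ⟩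
    degree G (embed C j)      ≡⟨ sym (degree-induced comp j) ⟩
    degree (induced G C) j    ∎
    where open ≡-Reasoning

  regular⇒balanced : (∀ C → IsComponent G C → Regular (induced G C)) → Balanced
  regular⇒balanced reg {u} {v} u~v = decidable-stable (degree G u ℕ.≟ degree G v) λ du≢dv →
    ¬¬-component u λ (C , u∈C , comp) → du≢dv (equal C u∈C comp)
    where
    equal : ∀ C → u ∈ C → IsComponent G C → degree G u ≡ degree G v
    equal C u∈C comp =
      let (i , i↦u) = embed-surjective u∈C
          (j , j↦v) = embed-surjective (Equivalence.from (proj₂ comp u∈C v) (u~v ◅ ε))
      in trans (cong (degree G) (sym i↦u)) (trans (sym (degree-induced comp i))
           (trans (reg C comp i j) (trans (degree-induced comp j) (cong (degree G) j↦v))))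

  -- An edge carries a proof of adjacency, so membership is only stated up to endpoints.
  edges-complete : ∀ {u v} → u <ᶠ v → u ~ v →
    Any (λ e → Edge.src e ≡ u × Edge.tgt e ≡ v) (edges G)
  edges-complete {u} {v} u<v u~v = mapMaybe⁺ _ (cartesianProduct (allFin n) (allFin n))
    (map⁺ (lose (∈-cartesianProduct⁺ (∈-allFin u) (∈-allFin v))
      (any-map-dec⇒maybe ((u <ᶠ? v) ×-dec (u ~? v)) (u<v , u~v) λ _ → refl , refl)))

  sddTerm-< : ∀ α β → 0ℝ <ℝ α → α <ℝ β → ∀ e →
    degree G (Edge.src e) ≢ degree G (Edge.tgt e) → sddTerm G α e <ℝ sddTerm G β e
  sddTerm-< α β 0<α α<β (edge u v _ u~v) = symmetricRatio-< (degree G u) (degree G v)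
    {{degree-nonZero G u~v}} {{degree-nonZero G (symm u~v)}} α β 0<α α<β

  sddTerm-≡ : ∀ α β e →
    degree G (Edge.src e) ≡ degree G (Edge.tgt e) → sddTerm G α e ≤ℝ sddTerm G β e
  sddTerm-≡ α β (edge u v _ u~v) = symmetricRatio-≡ (degree G u) (degree G v)
    {{degree-nonZero G u~v}} {{degree-nonZero G (symm u~v)}} α β

  sddTerm-≤ : ∀ α β → 0ℝ <ℝ α → α <ℝ β → ∀ e → sddTerm G α e ≤ℝ sddTerm G β e
  sddTerm-≤ α β 0<α α<β e with degree G (Edge.src e) ℕ.≟ degree G (Edge.tgt e)
  ... | yes eq = sddTerm-≡ α β e eq
  ... | no  ne = <ℝ⇒≤ℝ (sddTerm G α e) (sddTerm G β e) (sddTerm-< α β 0<α α<β e ne)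

  -- A single edge with unequal end degrees would make the sums strictly ordered, since every other
  -- term is weakly increasing.
  SDD-≥⇒balanced : ∀ α β → 0ℝ <ℝ α → α <ℝ β → SDD G β ≤ℝ SDD G α → Balanced
  SDD-≥⇒balanced α β 0<α α<β SDDβ≤SDDα {u} {v} u~v =
    decidable-stable (degree G u ℕ.≟ degree G v) λ ne → go ne (<ᶠ-cmp u v)
    where
    absurd : ∀ {u v} → u <ᶠ v → u ~ v → degree G u ≢ degree G v → ⊥
    absurd u<v u~v ne = <ℝ⇒≱ℝ (SDD G α) (SDD G β)
      (sumℝ-mono-< (sddTerm G α) (sddTerm G β) (sddTerm-≤ α β 0<α α<β)
        (Any.map (λ { {e} (refl , refl) → sddTerm-< α β 0<α α<β e ne }) (edges-complete u<v u~v)))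
      SDDβ≤SDDα
    -- `edges` lists each edge from its smaller endpoint, so the larger-to-smaller case is reduced
    -- by symmetry.
    go : degree G u ≢ degree G v → Tri (u <ᶠ v) (u ≡ v) (v <ᶠ u) → ⊥
    go ne (tri< u<v _ _) = absurd u<v u~v ne
    go ne (tri≈ _ u≡v _) = irrefl u≡v u~v
    go ne (tri> _ _ v<u) = absurd v<u (symm u~v) (λ eq → ne (sym eq))

theorem1 : (n : ℕ) (G : Graph n) (α β : ℝ) → 0ℝ <ℝ α → α <ℝ β →
    (SDD G α ≤ℝ SDD G β) ×
    ((SDD G α ≃ℝ SDD G β) ⇔
    ((C : Subset n) → IsComponent G C → Regular (induced G C)))
theorem1 n G α β 0<α α<β = SDDα≤SDDβ , mk⇔
    (λ (_ , SDDβ≤SDDα) → balanced⇒regular G (SDD-≥⇒balanced G α β 0<α α<β SDDβ≤SDDα))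
    -- With equal end degrees a term does not depend on the exponent, so the reverse inequality also
    -- holds term by term.
    (λ reg → SDDα≤SDDβ , sumℝ-mono-≤ (sddTerm G β) (sddTerm G α)
      (λ e → sddTerm-≡ G β α e (regular⇒balanced G reg (Edge.adjacent e))) (edges G))
  where
  SDDα≤SDDβ : SDD G α ≤ℝ SDD G β
  SDDα≤SDDβ = sumℝ-mono-≤ (sddTerm G α) (sddTerm G β) (sddTerm-≤ G α β 0<α α<β) (edges G)
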